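{- There is an $\omega$-model of $\mathrm{RCA}_0 + \mathrm{COH}$ that is not a model of $\mathrm{DNR}$. In particular, $\mathrm{COH}$ does not imply $\mathrm{DNR}$ over $\mathrm{RCA}_0$.
   Context: An $\omega$-model of $\mathrm{RCA}_0$ is identified with a Turing ideal (a nonempty subset of $2^\omega$ closed under Turing reducibility and join). An infinite set $X$ is cohesive for a family $R_0,R_1,\ldots$ of sets if for each $i$ one of $X\cap R_i$, $X\cap\overline{R_i}$ is finite. $\mathrm{COH}$ states that every family $\vec R=(R_i)_{i\in\mathbb N}$ (coded as a single set) has a cohesive set. $\mathrm{DNR}$ states that for every set $X$ there is a function $f$ with $f(e)\neq\Phi^X_e(e)$ for all $e$; an $\omega$-model satisfies it if for every $X$ in the model such an $f$ is in the model. -}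

module Defs where

open import Data.Bool using (Bool; true; if_then_else_; not; _∧_)
open import Data.Fin using (Fin; zero; suc; fromℕ; opposite; _↑ˡ_; lift)
open import Data.List using (List; _∷_; map)
open import Data.List.Membership.Propositional using (_∈_)
open import Data.Nat using (ℕ; zero; suc; _+_; _*_; _<_; _≡ᵇ_)
open import Data.Nat.DivMod using (_/_; _%_)
open import Data.Product using (∃-syntax; _×_)
open import Data.Sum using (_⊎_)
import Data.Vec as Vec
open import Function using (_∘_; _⇔_)
open import Level using (0ℓ)
open import Relation.Binary.PropositionalEquality using (_≡_; _≢_)
open import Relation.Unary using (Pred)

𝟚^ω : Set
𝟚^ω = ℕ → Bool

χ : 𝟚^ω → ℕ → ℕ
χ X n = if X n then 1 else 0

-- The usual pairing function of second-order arithmetic: injective, not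
-- surjective, and given by a term of the language of arithmetic.
⟨_,_⟩ : ℕ → ℕ → ℕ
⟨ x , y ⟩ = (x + y) * (x + y) + x

-- Φ X e x y means Φₑˣ(x)↓ = y: the partial recursive functionals generated
-- from the listed basic functions by pairing, composition, primitive recursion
-- and unbounded search, indexed directly by Gödel numbers. A number that is
-- not the index of a functional indexes the nowhere defined one.
-- The search functional with index ⟨ 9 , a ⟩ sends ⟨ x , n ⟩ to the least
-- p ≥ n such that Φₐ ⟨ x , p ⟩ = 0 (and Φₐ ⟨ x , q ⟩↓ ≠ 0 for n ≤ q < p).
data Φ (X : 𝟚^ω) : ℕ → ℕ → ℕ → Set where
  zer   : ∀ {x} → Φ X ⟨ 0 , 0 ⟩ x 0
  succ  : ∀ {x} → Φ X ⟨ 1 , 0 ⟩ x (x + 1)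
  iden  : ∀ {x} → Φ X ⟨ 2 , 0 ⟩ x x
  left  : ∀ {x y} → Φ X ⟨ 3 , 0 ⟩ ⟨ x , y ⟩ x
  right : ∀ {x y} → Φ X ⟨ 4 , 0 ⟩ ⟨ x , y ⟩ y
  query : ∀ {x} → Φ X ⟨ 5 , 0 ⟩ x (χ X x)
  pair  : ∀ {a b x y z} → Φ X a x y → Φ X b x z →
          Φ X ⟨ 6 , ⟨ a , b ⟩ ⟩ x ⟨ y , z ⟩
  comp  : ∀ {a b x y z} → Φ X b x y → Φ X a y z →
          Φ X ⟨ 7 , ⟨ a , b ⟩ ⟩ x z
  rec₀  : ∀ {a b x y} → Φ X a x y →
          Φ X ⟨ 8 , ⟨ a , b ⟩ ⟩ ⟨ x , 0 ⟩ y
  rec₊  : ∀ {a b x n y z} → Φ X ⟨ 8 , ⟨ a , b ⟩ ⟩ ⟨ x , n ⟩ y →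
          Φ X b ⟨ x , ⟨ n , y ⟩ ⟩ z →
          Φ X ⟨ 8 , ⟨ a , b ⟩ ⟩ ⟨ x , n + 1 ⟩ z
  stop  : ∀ {a x n} → Φ X a ⟨ x , n ⟩ 0 →
          Φ X ⟨ 9 , a ⟩ ⟨ x , n ⟩ n
  next  : ∀ {a x n y z} → Φ X a ⟨ x , n ⟩ (y + 1) →
          Φ X ⟨ 9 , a ⟩ ⟨ x , n + 1 ⟩ z →
          Φ X ⟨ 9 , a ⟩ ⟨ x , n ⟩ z

infix 4 _≤ᵀ_
_≤ᵀ_ : 𝟚^ω → 𝟚^ω → Set
X ≤ᵀ Y = ∃[ e ] ∀ n → Φ Y e n (χ X n)

_⊕_ : 𝟚^ω → 𝟚^ω → 𝟚^ω
(X ⊕ Y) n = if n % 2 ≡ᵇ 0 then X (n / 2) else Y (n / 2)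

record TuringIdeal (M : Pred 𝟚^ω 0ℓ) : Set where
  field
    nonempty : ∃[ X ] M X
    ≤ᵀ-closed : ∀ {X Y} → X ≤ᵀ Y → M Y → M X
    ⊕-closed  : ∀ {X Y} → M X → M Y → M (X ⊕ Y)

Finite Infinite : 𝟚^ω → Set
Finite   X = ∃[ b ] ∀ n → X n ≡ true → n < b
Infinite X = ∀ b → ∃[ n ] b < n × X n ≡ true

_∩_ : 𝟚^ω → 𝟚^ω → 𝟚^ω
(X ∩ Y) n = X n ∧ Y n

∁ : 𝟚^ω → 𝟚^ω
∁ X n = not (X n)

-- The i-th member of the family coded by R.
_⟦_⟧ : 𝟚^ω → ℕ → 𝟚^ω
(R ⟦ i ⟧) n = R ⟨ i , n ⟩

Cohesive : 𝟚^ω → 𝟚^ω → Set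
Cohesive R X = Infinite X × (∀ i → Finite (X ∩ (R ⟦ i ⟧)) ⊎ Finite (X ∩ ∁ (R ⟦ i ⟧)))

ModelsCOH : Pred 𝟚^ω 0ℓ → Set
ModelsCOH M = ∀ R → M R → ∃[ X ] M X × Cohesive R X

-- A function belongs to M if M contains a set coding its graph.
_∈ᶠ_ : (ℕ → ℕ) → Pred 𝟚^ω 0ℓ → Set
f ∈ᶠ M = ∃[ F ] M F × (∀ n y → F ⟨ n , y ⟩ ≡ true ⇔ f n ≡ y)

DNRFor : 𝟚^ω → (ℕ → ℕ) → Set
DNRFor X f = ∀ e y → Φ X e e y → f e ≢ y

ModelsDNR : Pred 𝟚^ω 0ℓ → Set
ModelsDNR M = ∀ X → M X → ∃[ f ] f ∈ᶠ M × DNRFor X f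

-- The language of second-order arithmetic, with well-scoped de Bruijn
-- indices: m free number variables and k free set variables.

infixl 7 _·̇_
infixl 6 _+̇_
infix  5 _≈̇_ _<̇_ _∈̇_
infixr 4 _∧̇_
infixr 3 _∨̇_
infixr 2 _⇒̇_ _⇔̇_

data Term (m : ℕ) : Set where
  var     : Fin m → Term m
  0̇ 1̇     : Term m
  _+̇_ _·̇_ : Term m → Term m → Term m

data Form (m k : ℕ) : Set where
  _≈̇_ _<̇_     : Term m → Term m → Form m k
  _∈̇_         : Term m → Fin k → Form m k
  ⊥̇           : Form m k
  _∧̇_ _∨̇_ _⇒̇_ : Form m k → Form m k → Form m k
  ∀̇ ∃̇         : Form (suc m) k → Form m k
  ∀̇² ∃̇²       : Form m (suc k) → Form m k

¬̇_ : ∀ {m k} → Form m k → Form m k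
¬̇ φ = φ ⇒̇ ⊥̇

_⇔̇_ : ∀ {m k} → Form m k → Form m k → Form m k
φ ⇔̇ ψ = (φ ⇒̇ ψ) ∧̇ (ψ ⇒̇ φ)

subᵗ : ∀ {m m′} → (Fin m → Term m′) → Term m → Term m′
subᵗ σ (var i) = σ i
subᵗ σ 0̇       = 0̇
subᵗ σ 1̇       = 1̇
subᵗ σ (s +̇ t) = subᵗ σ s +̇ subᵗ σ t
subᵗ σ (s ·̇ t) = subᵗ σ s ·̇ subᵗ σ t

wkᵗ : ∀ {m} → Term m → Term (suc m)
wkᵗ = subᵗ (var ∘ suc)

ext : ∀ {m m′} → (Fin m → Term m′) → Fin (suc m) → Term (suc m′)
ext σ zero    = var zero
ext σ (suc i) = wkᵗ (σ i)

sub : ∀ {m m′ k} → (Fin m → Term m′) → Form m k → Form m′ k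
sub σ (s ≈̇ t) = subᵗ σ s ≈̇ subᵗ σ t
sub σ (s <̇ t) = subᵗ σ s <̇ subᵗ σ t
sub σ (t ∈̇ X) = subᵗ σ t ∈̇ X
sub σ ⊥̇       = ⊥̇
sub σ (φ ∧̇ ψ) = sub σ φ ∧̇ sub σ ψ
sub σ (φ ∨̇ ψ) = sub σ φ ∨̇ sub σ ψ
sub σ (φ ⇒̇ ψ) = sub σ φ ⇒̇ sub σ ψ
sub σ (∀̇ φ)   = ∀̇ (sub (ext σ) φ)
sub σ (∃̇ φ)   = ∃̇ (sub (ext σ) φ)
sub σ (∀̇² φ)  = ∀̇² (sub σ φ)
sub σ (∃̇² φ)  = ∃̇² (sub σ φ)

-- Set variables are the only set terms, so substituting for them is renaming.
ren² : ∀ {m k k′} → (Fin k → Fin k′) → Form m k → Form m k′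
ren² ρ (s ≈̇ t) = s ≈̇ t
ren² ρ (s <̇ t) = s <̇ t
ren² ρ (t ∈̇ X) = t ∈̇ ρ X
ren² ρ ⊥̇       = ⊥̇
ren² ρ (φ ∧̇ ψ) = ren² ρ φ ∧̇ ren² ρ ψ
ren² ρ (φ ∨̇ ψ) = ren² ρ φ ∨̇ ren² ρ ψ
ren² ρ (φ ⇒̇ ψ) = ren² ρ φ ⇒̇ ren² ρ ψ
ren² ρ (∀̇ φ)   = ∀̇ (ren² ρ φ)
ren² ρ (∃̇ φ)   = ∃̇ (ren² ρ φ)
ren² ρ (∀̇² φ)  = ∀̇² (ren² (lift 1 ρ) φ)
ren² ρ (∃̇² φ)  = ∃̇² (ren² (lift 1 ρ) φ)

wk : ∀ {m k} → Form m k → Form (suc m) k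
wk = sub (var ∘ suc)

wk² : ∀ {m k} → Form m k → Form m (suc k)
wk² = ren² suc

inst : ∀ {m} → Term m → Fin (suc m) → Term m
inst t zero    = t
inst t (suc i) = var i

_[_] : ∀ {m k} → Form (suc m) k → Term m → Form m k
φ [ t ] = sub (inst t) φ

inst² : ∀ {k} → Fin k → Fin (suc k) → Fin k
inst² X zero    = X
inst² X (suc Y) = Y

_[_]² : ∀ {m k} → Form m (suc k) → Fin k → Form m k
φ [ X ]² = ren² (inst² X) φ

shift : ∀ {m} → Fin (suc m) → Term (suc m)
shift zero    = var zero +̇ 1̇
shift (suc i) = var (suc i)

∀̇< ∃̇< : ∀ {m k} → Term m → Form (suc m) k → Form m k
∀̇< t φ = ∀̇ (var zero <̇ wkᵗ t ⇒̇ φ)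
∃̇< t φ = ∃̇ (var zero <̇ wkᵗ t ∧̇ φ)

data Δ⁰₀ {m k} : Form m k → Set where
  eq   : ∀ {s t} → Δ⁰₀ (s ≈̇ t)
  lt   : ∀ {s t} → Δ⁰₀ (s <̇ t)
  mem  : ∀ {t X} → Δ⁰₀ (t ∈̇ X)
  bot  : Δ⁰₀ ⊥̇
  conj : ∀ {φ ψ} → Δ⁰₀ φ → Δ⁰₀ ψ → Δ⁰₀ (φ ∧̇ ψ)
  disj : ∀ {φ ψ} → Δ⁰₀ φ → Δ⁰₀ ψ → Δ⁰₀ (φ ∨̇ ψ)
  impl : ∀ {φ ψ} → Δ⁰₀ φ → Δ⁰₀ ψ → Δ⁰₀ (φ ⇒̇ ψ)
  all< : ∀ {t φ} → Δ⁰₀ φ → Δ⁰₀ (∀̇< t φ)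
  ex<  : ∀ {t φ} → Δ⁰₀ φ → Δ⁰₀ (∃̇< t φ)

data Σ⁰₁ {m k} : Form m k → Set where
  ex  : ∀ {φ} → Δ⁰₀ φ → Σ⁰₁ (∃̇ φ)

data Π⁰₁ {m k} : Form m k → Set where
  all : ∀ {φ} → Δ⁰₀ φ → Π⁰₁ (∀̇ φ)

-- Axioms may have free variables and are available in every scope, which
-- amounts to taking their universal closures.
data RCA₀ {m k} : Form m k → Set where
  suc≢0   : ∀ s → RCA₀ (¬̇ (s +̇ 1̇ ≈̇ 0̇))
  suc-inj : ∀ s t → RCA₀ (s +̇ 1̇ ≈̇ t +̇ 1̇ ⇒̇ s ≈̇ t)
  +-zero  : ∀ s → RCA₀ (s +̇ 0̇ ≈̇ s)
  +-suc   : ∀ s t → RCA₀ (s +̇ (t +̇ 1̇) ≈̇ (s +̇ t) +̇ 1̇)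
  ·-zero  : ∀ s → RCA₀ (s ·̇ 0̇ ≈̇ 0̇)
  ·-suc   : ∀ s t → RCA₀ (s ·̇ (t +̇ 1̇) ≈̇ s ·̇ t +̇ s)
  <-zero  : ∀ s → RCA₀ (¬̇ (s <̇ 0̇))
  <-suc   : ∀ s t → RCA₀ (s <̇ t +̇ 1̇ ⇔̇ (s <̇ t ∨̇ s ≈̇ t))
  Σ⁰₁-induction     : ∀ {φ} → Σ⁰₁ φ →
    RCA₀ (φ [ 0̇ ] ∧̇ ∀̇ (φ ⇒̇ sub shift φ) ⇒̇ ∀̇ φ)
  Δ⁰₁-comprehension : ∀ {φ ψ} → Σ⁰₁ φ → Π⁰₁ ψ →
    RCA₀ (∀̇ (φ ⇔̇ ψ) ⇒̇ ∃̇² (∀̇ (var zero ∈̇ zero ⇔̇ wk² φ)))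

-- Γ ⊢ φ: classical two-sorted natural deduction from the axioms of RCA₀
-- and the hypotheses Γ.
infix 1 _⊢_
data _⊢_ {m k} (Γ : List (Form m k)) : Form m k → Set where
  ax   : ∀ {φ} → RCA₀ φ → Γ ⊢ φ
  hyp  : ∀ {φ} → φ ∈ Γ → Γ ⊢ φ
  raa  : ∀ {φ} → ¬̇ φ ∷ Γ ⊢ ⊥̇ → Γ ⊢ φ
  ⇒I   : ∀ {φ ψ} → φ ∷ Γ ⊢ ψ → Γ ⊢ φ ⇒̇ ψ
  ⇒E   : ∀ {φ ψ} → Γ ⊢ φ ⇒̇ ψ → Γ ⊢ φ → Γ ⊢ ψ
  ∧I   : ∀ {φ ψ} → Γ ⊢ φ → Γ ⊢ ψ → Γ ⊢ φ ∧̇ ψ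
  ∧E₁  : ∀ {φ ψ} → Γ ⊢ φ ∧̇ ψ → Γ ⊢ φ
  ∧E₂  : ∀ {φ ψ} → Γ ⊢ φ ∧̇ ψ → Γ ⊢ ψ
  ∨I₁  : ∀ {φ ψ} → Γ ⊢ φ → Γ ⊢ φ ∨̇ ψ
  ∨I₂  : ∀ {φ ψ} → Γ ⊢ ψ → Γ ⊢ φ ∨̇ ψ
  ∨E   : ∀ {φ ψ θ} → Γ ⊢ φ ∨̇ ψ → φ ∷ Γ ⊢ θ → ψ ∷ Γ ⊢ θ → Γ ⊢ θ
  ∀I   : ∀ {φ} → map wk Γ ⊢ φ → Γ ⊢ ∀̇ φ
  ∀E   : ∀ {φ} → Γ ⊢ ∀̇ φ → ∀ t → Γ ⊢ φ [ t ]
  ∃I   : ∀ {φ} t → Γ ⊢ φ [ t ] → Γ ⊢ ∃̇ φ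
  ∃E   : ∀ {φ θ} → Γ ⊢ ∃̇ φ → φ ∷ map wk Γ ⊢ wk θ → Γ ⊢ θ
  ∀²I  : ∀ {φ} → map wk² Γ ⊢ φ → Γ ⊢ ∀̇² φ
  ∀²E  : ∀ {φ} → Γ ⊢ ∀̇² φ → ∀ X → Γ ⊢ φ [ X ]²
  ∃²I  : ∀ {φ} X → Γ ⊢ φ [ X ]² → Γ ⊢ ∃̇² φ
  ∃²E  : ∀ {φ θ} → Γ ⊢ ∃̇² φ → φ ∷ map wk² Γ ⊢ wk² θ → Γ ⊢ θ
  ≈I   : ∀ {t} → Γ ⊢ t ≈̇ t
  ≈E   : ∀ {φ s t} → Γ ⊢ s ≈̇ t → Γ ⊢ φ [ s ] → Γ ⊢ φ [ t ]

⟨_,̇_⟩ : ∀ {m} → Term m → Term m → Term m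
⟨ s ,̇ t ⟩ = (s +̇ t) ·̇ (s +̇ t) +̇ s

num : ∀ {m} → ℕ → Term m
num zero    = 0̇
num (suc n) = num n +̇ 1̇

-- The number variable bound at de Bruijn level l (counted from the outside),
-- usable unchanged under further quantifiers.
level : ∀ l {m} → Term (suc l + m)
level l {m} = var (opposite (fromℕ l ↑ˡ m))

COH : Form 0 0
COH = ∀̇² (∃̇² (infinite ∧̇ ∀̇ (∃̇ (∀̇ (n ∈̇ X ∧̇ ⟨ i ,̇ n ⟩ ∈̇ R ⇒̇ n <̇ b))
                          ∨̇ ∃̇ (∀̇ (n ∈̇ X ∧̇ ¬̇ (⟨ i ,̇ n ⟩ ∈̇ R) ⇒̇ n <̇ b)))))
  where
  R X : Fin 2
  R = suc zero
  X = zero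
  infinite : Form 0 2
  infinite = ∀̇ (∃̇ (level 0 <̇ level 1 ∧̇ level 1 ∈̇ X))
  i b n : Term 3
  i = level 0
  b = level 1
  n = level 2

-- The arithmetisation of Φ. The triple (k , m , n) codes the finite set D of
-- all i < k such that m (i + 1) + 1 divides n; every finite set has such a
-- code. An element ⟨t,⟨c,⟨u,w⟩⟩⟩ of D is a step of a derivation, asserting at
-- time t that Φ_c(u) = w; each step must follow, by one of the clauses
-- defining Φ, from steps with earlier times. All quantifiers but those over
-- k, m, n and the time of the final step are bounded.
module Arithmetisation {s} (X : Fin s) where

  inD : ∀ {j} → Term (6 + j) → Form (6 + j) s
  inD i = i <̇ k ∧̇ ∃̇< (n +̇ 1̇) ((wkᵗ m ·̇ (wkᵗ i +̇ 1̇) +̇ 1̇) ·̇ var zero ≈̇ wkᵗ n)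
    where
    k = level 3
    m = level 4
    n = level 5

  step : ∀ {j} (t c u w : Term (6 + j)) → Form (6 + j) s
  step t c u w = inD ⟨ t ,̇ ⟨ c ,̇ ⟨ u ,̇ w ⟩ ⟩ ⟩

  justified : Form 10 s
  justified =
      (c ≈̇ ⟨ num 0 ,̇ 0̇ ⟩ ∧̇ w ≈̇ 0̇)
    ∨̇ (c ≈̇ ⟨ num 1 ,̇ 0̇ ⟩ ∧̇ w ≈̇ u +̇ 1̇)
    ∨̇ (c ≈̇ ⟨ num 2 ,̇ 0̇ ⟩ ∧̇ w ≈̇ u)
    ∨̇ (c ≈̇ ⟨ num 3 ,̇ 0̇ ⟩ ∧̇ ∃̇< k (level 8 ≈̇ ⟨ level 9 ,̇ level 10 ⟩))
    ∨̇ (c ≈̇ ⟨ num 4 ,̇ 0̇ ⟩ ∧̇ ∃̇< k (level 8 ≈̇ ⟨ level 10 ,̇ level 9 ⟩))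
    ∨̇ (c ≈̇ ⟨ num 5 ,̇ 0̇ ⟩ ∧̇ ((u ∈̇ X ∧̇ w ≈̇ 1̇) ∨̇ (¬̇ (u ∈̇ X) ∧̇ w ≈̇ 0̇)))
    ∨̇ pair-rule ∨̇ comp-rule ∨̇ rec₀-rule ∨̇ rec₊-rule ∨̇ stop-rule ∨̇ next-rule
    where
    k : ∀ {j} → Term (4 + j)
    k = level 3
    t : ∀ {j} → Term (7 + j)
    t = level 6
    c : ∀ {j} → Term (8 + j)
    c = level 7
    u : ∀ {j} → Term (9 + j)
    u = level 8
    w : ∀ {j} → Term (10 + j)
    w = level 9
    a : ∀ {j} → Term (11 + j)
    a = level 10
    b : ∀ {j} → Term (12 + j)
    b = level 11
    p : ∀ {j} → Term (13 + j)
    p = level 12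
    q : ∀ {j} → Term (14 + j)
    q = level 13
    r : ∀ {j} → Term (15 + j)
    r = level 14
    earlier : ∀ {j} (c′ u′ w′ : Term (7 + j)) → Form (7 + j) s
    earlier c′ u′ w′ = ∃̇< t (step (var zero) (wkᵗ c′) (wkᵗ u′) (wkᵗ w′))
    pair-rule comp-rule rec₀-rule rec₊-rule stop-rule next-rule : Form 10 s
    pair-rule = ∃̇< k (∃̇< k (∃̇< k (∃̇< k
      (c ≈̇ ⟨ num 6 ,̇ ⟨ a ,̇ b ⟩ ⟩ ∧̇ w ≈̇ ⟨ p ,̇ q ⟩ ∧̇ earlier a u p ∧̇ earlier b u q))))
    comp-rule = ∃̇< k (∃̇< k (∃̇< k
      (c ≈̇ ⟨ num 7 ,̇ ⟨ a ,̇ b ⟩ ⟩ ∧̇ earlier b u p ∧̇ earlier a p w)))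
    rec₀-rule = ∃̇< k (∃̇< k (∃̇< k
      (c ≈̇ ⟨ num 8 ,̇ ⟨ a ,̇ b ⟩ ⟩ ∧̇ u ≈̇ ⟨ p ,̇ 0̇ ⟩ ∧̇ earlier a p w)))
    rec₊-rule = ∃̇< k (∃̇< k (∃̇< k (∃̇< k (∃̇< k
      (c ≈̇ ⟨ num 8 ,̇ ⟨ a ,̇ b ⟩ ⟩ ∧̇ u ≈̇ ⟨ p ,̇ q +̇ 1̇ ⟩ ∧̇
       earlier c ⟨ p ,̇ q ⟩ r ∧̇ earlier b ⟨ p ,̇ ⟨ q ,̇ r ⟩ ⟩ w)))))
    stop-rule = ∃̇< k (∃̇< k
      (c ≈̇ ⟨ num 9 ,̇ a ⟩ ∧̇ u ≈̇ ⟨ b ,̇ w ⟩ ∧̇ earlier a u 0̇))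
    next-rule = ∃̇< k (∃̇< k (∃̇< k (∃̇< k
      (c ≈̇ ⟨ num 9 ,̇ a ⟩ ∧̇ u ≈̇ ⟨ b ,̇ p ⟩ ∧̇
       earlier a u (q +̇ 1̇) ∧̇ earlier c ⟨ b ,̇ p +̇ 1̇ ⟩ w))))

  -- The free variables are, by level, the index, the argument and the value.
  formula : Form 3 s
  formula = ∃̇ (∃̇ (∃̇ (
      ∃̇ (step (level 6) (level 0) (level 1) (level 2))
    ∧̇ ∀̇< k (∀̇< k (∀̇< k (∀̇< k
        (step (level 6) (level 7) (level 8) (level 9) ⇒̇ justified)))))))
    where
    k : ∀ {j} → Term (4 + j)
    k = level 3

Φ̇ : ∀ {m s} → Fin s → (e x y : Term m) → Form m s
Φ̇ X e x y = sub (Vec.lookup (y Vec.∷ x Vec.∷ e Vec.∷ Vec.[])) (Arithmetisation.formula X)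

DNR : Form 0 0
DNR = ∀̇² (∃̇² (function ∧̇ ∀̇ (∀̇ (⟨ e ,̇ y ⟩ ∈̇ F ⇒̇ ¬̇ (Φ̇ X e e y)))))
  where
  X F : Fin 2
  X = suc zero
  F = zero
  function : Form 0 2
  function = ∀̇ (∃̇ (⟨ level 0 ,̇ level 1 ⟩ ∈̇ F
                   ∧̇ ∀̇ (⟨ level 0 ,̇ level 2 ⟩ ∈̇ F ⇒̇ level 2 ≈̇ level 1)))
  e y : Term 2
  e = level 0
  y = level 1

{-# OPTIONS --safe #-}

-- Call Z good if no Z-computable function is DNR (relative to ∅); ∅ is good
-- because Φₑ agrees with itself at e. Given a good Z, Mathias forcing with
-- Z-computable reservoirs yields an infinite G which is cohesive for all
-- Z-computable sets at once, with Z ⊕ G good. Indeed, given an index e and a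
-- condition, either some x has no extension of the stem making Φₑ(x) converge,
-- and Φₑ is then not total on Z ⊕ G, or searching for such extensions computes
-- a total g from Z; as g is not DNR, some g x equals Φₓ(x), and passing to the
-- extension that gave g x makes Φₑ wrong at x. Iterating Z ↦ Z ⊕ G from ∅, the
-- sets computable from some stage form the required ideal. Like every Turing
-- ideal it is an ω-model of RCA₀, so the unprovability follows by soundness.
module Submission where

open import Defs
open import Axiom.ExcludedMiddle using (ExcludedMiddle)
open import Data.Bool using (Bool; true; false; if_then_else_; not; _∧_)
open import Data.Bool.Properties using (¬-not)
open import Data.Empty using (⊥; ⊥-elim)
open import Data.Fin using (Fin; zero; suc; #_; lift)
open import Data.List using (List; []; _∷_; _++_)
open import Data.List.Membership.DecPropositional using (_∈?_)
open import Data.List.Membership.Propositional using (_∈_)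
open import Data.List.Membership.Propositional.Properties using (∈-++⁺ˡ; ∈-++⁺ʳ; ∈-++⁻)
open import Data.List.Relation.Unary.All using (All; []; _∷_)
import Data.List.Relation.Unary.All as All
import Data.List.Relation.Unary.All.Properties as All
open import Data.List.Relation.Unary.Any using (here; there)
open import Data.Nat using (ℕ; zero; suc; _+_; _*_; _∸_; _≤_; _<_; z≤n; s≤s; _≤?_; _<?_; _≟_; _⊔_; pred)
open import Data.Nat using (_≡ᵇ_; _!; >-nonZero)
open import Data.Nat.Coprimality using (Coprime; coprime-divisor)
import Data.Nat.Coprimality as Coprimality
open import Data.Nat.Divisibility
open import Data.Nat.DivMod using (_/_; _%_; m≡m%n+[m/n]*n; m%n<n; m%n≡m∸m/n*n; m*n/n≡m; m*n%n≡0; m/n≤m; [m+kn]%n≡m%n)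
open import Data.Nat.Properties renaming (+-suc to n+1+m≡1+n+m)
open import Data.Nat.Tactic.RingSolver using (solve-∀)
open import Data.Product using (∃-syntax; Σ-syntax; _×_; _,_; proj₁; proj₂)
open import Data.Sum using (_⊎_; inj₁; inj₂; [_,_]′)
import Data.Sum as Sum
open import Data.Vec using (Vec; []; _∷_; lookup; head; tail; drop)
open import Function using (_∘_; id; _⇔_; mk⇔; Equivalence)
open import Level using (0ℓ)
open import Relation.Binary.Definitions using (tri<; tri≈; tri>)
open import Relation.Binary.PropositionalEquality using (_≡_; _≢_; refl; sym; trans; cong; cong₂; subst)
open import Relation.Nullary using (¬_; Dec; yes; no)
open import Relation.Nullary.Decidable using (⌊_⌋)

-- The search for extensions must be one computation from `Z`, although the oracle `Z ⊕ G` varies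
-- with the extension. The index `e` is fixed, however, so it is decoded once into a syntax tree, a
-- `Code`, and an evaluator for that single program is assembled by recursion on the tree; no
-- universal machine has to be programmed. Its oracle comes from a family decidable uniformly in
-- `Z`. The same evaluator shows that `Φ` is single-valued and that reducibility is transitive.
--
-- Indices are obtained from combinators for total functions and decidable predicates. Unbounded
-- search supplies a value wherever its existence is known, possibly only by excluded middle.
--
-- For the unprovability, `Φ̇` stands under a negation in `DNR`, so the implication from `Φ` to `Φ̇`
-- is what turns truth of `DNR` in the ideal into `ModelsDNR`. It calls for numbers coding each
-- derivation, which are built from the moduli of Gödel's β-function.

open Equivalence using (to; from)

-- Pairing

root : ℕ → ℕ
root zero = 0
root (suc n) with suc (root n) * suc (root n) ≤? suc n
... | yes _ = suc (root n)
... | no  _ = root n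

root-lower : ∀ n → root n * root n ≤ n
root-lower zero = z≤n
root-lower (suc n) with suc (root n) * suc (root n) ≤? suc n
... | yes p = p
... | no  _ = m≤n⇒m≤1+n (root-lower n)

root-upper : ∀ n → n < suc (root n) * suc (root n)
root-upper zero = s≤s z≤n
root-upper (suc n) with suc (root n) * suc (root n) ≤? suc n
... | yes _ = ≤-<-trans (root-upper n) (*-mono-< (n<1+n (suc (root n))) (n<1+n (suc (root n))))
... | no  p = ≰⇒> p

root-unique : ∀ {n s} → s * s ≤ n → n < suc s * suc s → s ≡ root n
root-unique {n} {s} lo up = ≤-antisym (below lo (root-upper n)) (below (root-lower n) up)
  where
  below : ∀ {r t} → r * r ≤ n → n < suc t * suc t → r ≤ t
  below {r} {t} p q with r ≤? t
  ... | yes r≤t = r≤t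
  ... | no  r≰t = ⊥-elim (<⇒≱ q (≤-trans (*-mono-≤ (≰⇒> r≰t) (≰⇒> r≰t)) p))

-- Inverse to pairing because `⟨ x , y ⟩` lies between the squares of `x + y` and of its successor.
-- On numbers that are not pairs the values are junk, and pairs are recognised by pairing the
-- projections again.
π₁ π₂ : ℕ → ℕ
π₁ n = n ∸ root n * root n
π₂ n = root n ∸ π₁ n

root-⟨⟩ : ∀ x y → root ⟨ x , y ⟩ ≡ x + y
root-⟨⟩ x y = sym (root-unique (m≤m+n _ x) (s≤s (begin
  s * s + x       ≤⟨ +-monoʳ-≤ (s * s) (m≤m+n x y) ⟩
  s * s + s       ≡⟨ +-comm (s * s) s ⟩
  s + s * s       ≡⟨ *-suc s s ⟨
  s * suc s       ≤⟨ m≤n+m (s * suc s) s ⟩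
  s + s * suc s   ∎)))
  where
  open ≤-Reasoning
  s = x + y

π₁-⟨⟩ : ∀ x y → π₁ ⟨ x , y ⟩ ≡ x
π₁-⟨⟩ x y rewrite root-⟨⟩ x y = m+n∸m≡n ((x + y) * (x + y)) x

π₂-⟨⟩ : ∀ x y → π₂ ⟨ x , y ⟩ ≡ y
π₂-⟨⟩ x y rewrite π₁-⟨⟩ x y | root-⟨⟩ x y = m+n∸m≡n x y

⟨⟩-injective : ∀ {x y x′ y′} → ⟨ x , y ⟩ ≡ ⟨ x′ , y′ ⟩ → x ≡ x′ × y ≡ y′
⟨⟩-injective {x} {y} {x′} {y′} eqn =
    trans (sym (π₁-⟨⟩ x y)) (trans (cong π₁ eqn) (π₁-⟨⟩ x′ y′))
  , trans (sym (π₂-⟨⟩ x y)) (trans (cong π₂ eqn) (π₂-⟨⟩ x′ y′))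

m≤m*m : ∀ m → m ≤ m * m
m≤m*m zero    = z≤n
m≤m*m (suc m) = m≤m*n (suc m) (suc m)

+≤⟨⟩ : ∀ x y → x + y ≤ ⟨ x , y ⟩
+≤⟨⟩ x y = ≤-trans (m≤m*m (x + y)) (m≤m+n _ x)

≤⟨⟩₁ : ∀ x y → x ≤ ⟨ x , y ⟩
≤⟨⟩₁ x y = ≤-trans (m≤m+n x y) (+≤⟨⟩ x y)

≤⟨⟩₂ : ∀ x y → y ≤ ⟨ x , y ⟩
≤⟨⟩₂ x y = ≤-trans (m≤n+m y x) (+≤⟨⟩ x y)

-- Computable functions and decidable predicates

natrec : {A : Set} → A → (ℕ → A → A) → ℕ → A
natrec z s zero    = z
natrec z s (suc n) = s n (natrec z s n)

-- Putting the newest variable on the right matches the argument order that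
-- the recursion and search functionals expect.
enc : ∀ {n} → Vec ℕ n → ℕ
enc []      = 0
enc (x ∷ v) = ⟨ enc v , x ⟩

record Computable (Z : 𝟚^ω) {n} (f : Vec ℕ n → ℕ) : Set where
  constructor computable
  field
    index : ℕ
    run   : ∀ v → Φ Z index (enc v) (f v)

record Computables (Z : 𝟚^ω) {n k} (F : Vec ℕ n → Vec ℕ k) : Set where
  constructor computables
  field
    index : ℕ
    run   : ∀ v → Φ Z index (enc v) (enc (F v))

abstract
  suc-index : ∀ Z {x y} → y ≡ x + 1 → Φ Z ⟨ 1 , 0 ⟩ x y
  suc-index Z refl = succ

  leftᵣ : ∀ {Z} x y → Φ Z ⟨ 3 , 0 ⟩ ⟨ x , y ⟩ x
  leftᵣ x y = left {x = x} {y}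

  rightᵣ : ∀ {Z} x y → Φ Z ⟨ 4 , 0 ⟩ ⟨ x , y ⟩ y
  rightᵣ x y = right {x = x} {y}

  pairᵢ : ℕ → ℕ → ℕ
  pairᵢ a b = ⟨ 6 , ⟨ a , b ⟩ ⟩

  pairᵣ : ∀ {Z x y z} a b → Φ Z a x y → Φ Z b x z → Φ Z (pairᵢ a b) x ⟨ y , z ⟩
  pairᵣ a b = pair

  compᵢ : ℕ → ℕ → ℕ
  compᵢ a b = ⟨ 7 , ⟨ a , b ⟩ ⟩

  compᵣ : ∀ {Z x y z} a b → Φ Z b x y → Φ Z a y z → Φ Z (compᵢ a b) x z
  compᵣ a b = comp

  recᵢ : ℕ → ℕ → ℕ
  recᵢ a b = ⟨ 8 , ⟨ a , b ⟩ ⟩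

  recᵣ : ∀ {Z x} a b (f : ℕ) (g : ℕ → ℕ → ℕ) → Φ Z a x f →
         (∀ i y → Φ Z b ⟨ x , ⟨ i , y ⟩ ⟩ (g i y)) →
         ∀ n → Φ Z (recᵢ a b) ⟨ x , n ⟩ (natrec f g n)
  recᵣ {x = x} a b f g p q zero    = rec₀ {a = a} {b} {x} p
  recᵣ {Z} {x} a b f g p q (suc n) =
    subst (λ i → Φ Z (recᵢ a b) ⟨ x , i ⟩ (natrec f g (suc n))) (+-comm n 1)
      (rec₊ {a = a} {b} {x} {n} {natrec f g n} (recᵣ a b f g p q n) (q n _))

  searchᵢ : ℕ → ℕ
  searchᵢ a = ⟨ 9 , a ⟩

  -- The known zero at `d + n` only bounds the recursion; the `p` returned is the first zero from
  -- `n` on.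
  searchᵣ : ∀ {Z} x a (t : ℕ → ℕ) → (∀ p → Φ Z a ⟨ x , p ⟩ (t p)) →
            ∀ d n → t (d + n) ≡ 0 →
            ∃[ p ] t p ≡ 0 × Φ Z (searchᵢ a) ⟨ x , n ⟩ p
  searchᵣ {Z} x a t run zero n hit = n , hit , stop {a = a} {x} {n} (subst (Φ Z a ⟨ x , n ⟩) hit (run n))
  searchᵣ {Z} x a t run (suc d) n hit with t n in eqn
  ... | zero  = n , eqn , stop {a = a} {x} {n} (subst (Φ Z a ⟨ x , n ⟩) eqn (run n))
  ... | suc y with searchᵣ x a t run d (suc n) (trans (cong t (n+1+m≡1+n+m d n)) hit)
  ...   | p , tp , φ = p , tp ,
    next {a = a} {x} {n} {y} (subst (Φ Z a ⟨ x , n ⟩) (trans eqn (+-comm 1 y)) (run n))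
         (subst (λ i → Φ Z (searchᵢ a) ⟨ x , i ⟩ p) (+-comm 1 n) φ)

module _ {Z : 𝟚^ω} where

  cong-comp : ∀ {n} {f g : Vec ℕ n → ℕ} → (∀ v → f v ≡ g v) → Computable Z f → Computable Z g
  cong-comp eqn (computable e r) = computable e λ v → subst (Φ Z e (enc v)) (eqn v) (r v)

  infixl 9 _∘ᶜ_
  _∘ᶜ_ : ∀ {n k} {g : Vec ℕ k → ℕ} {F : Vec ℕ n → Vec ℕ k} →
         Computable Z g → Computables Z F → Computable Z (λ v → g (F v))
  computable a r ∘ᶜ computables b s = computable (compᵢ a b) λ v → compᵣ a b (s v) (r _)

  []ᶜ : ∀ {n} → Computables Z {n} (λ _ → [])
  []ᶜ = computables ⟨ 0 , 0 ⟩ λ v → zer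

  infixr 5 _∷ᶜ_
  _∷ᶜ_ : ∀ {n k} {f : Vec ℕ n → ℕ} {F : Vec ℕ n → Vec ℕ k} →
         Computable Z f → Computables Z F → Computables Z (λ v → f v ∷ F v)
  computable a r ∷ᶜ computables b s = computables (pairᵢ b a) λ v → pairᵣ b a (s v) (r v)

  idᶜ : ∀ {n} → Computables Z {n} (λ v → v)
  idᶜ = computables ⟨ 2 , 0 ⟩ λ v → iden

  varᶜ : ∀ {n} (i : Fin n) → Computable Z (λ v → lookup v i)
  varᶜ zero    = computable ⟨ 4 , 0 ⟩ λ { (x ∷ v) → rightᵣ (enc v) x }
  varᶜ (suc i) with varᶜ i
  ... | computable e r = computable (compᵢ e ⟨ 3 , 0 ⟩) λ { (x ∷ v) → compᵣ e ⟨ 3 , 0 ⟩ (leftᵣ (enc v) x) (r v) }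

  #0 : ∀ {n} → Computable Z (λ (v : Vec ℕ (1 + n)) → lookup v zero)
  #0 = varᶜ zero

  headᶜ : ∀ {n} → Computable Z {suc n} head
  headᶜ = cong-comp (λ { (x ∷ v) → refl }) #0

  #1 : ∀ {n} → Computable Z (λ (v : Vec ℕ (2 + n)) → lookup v (suc zero))
  #1 = varᶜ (suc zero)

  #2 : ∀ {n} → Computable Z (λ (v : Vec ℕ (3 + n)) → lookup v (suc (suc zero)))
  #2 = varᶜ (suc (suc zero))

  tailᶜ : ∀ {n} → Computables Z {suc n} tail
  tailᶜ = computables ⟨ 3 , 0 ⟩ λ { (x ∷ v) → leftᵣ (enc v) x }

  dropᶜ : ∀ m {n} → Computables Z {m + n} (drop m)
  dropᶜ zero    = idᶜ
  dropᶜ (suc m) with dropᶜ m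
  ... | computables e r = computables (compᵢ e ⟨ 3 , 0 ⟩) λ { (x ∷ v) → compᵣ e ⟨ 3 , 0 ⟩ (leftᵣ (enc v) x) (r v) }

  sucᶜ : ∀ {n} {f : Vec ℕ n → ℕ} → Computable Z f → Computable Z (λ v → suc (f v))
  sucᶜ {f = f} (computable e r) =
    computable (compᵢ ⟨ 1 , 0 ⟩ e) λ v → compᵣ ⟨ 1 , 0 ⟩ e (r v) (suc-index Z (+-comm 1 (f v)))

  constᶜ : ∀ {n} c → Computable Z {n} (λ _ → c)
  constᶜ zero    = computable ⟨ 0 , 0 ⟩ λ v → zer
  constᶜ (suc c) = sucᶜ (constᶜ c)

  ⟨_,_⟩ᶜ : ∀ {n} {f g : Vec ℕ n → ℕ} → Computable Z f → Computable Z g → Computable Z (λ v → ⟨ f v , g v ⟩)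
  ⟨ computable a r , computable b s ⟩ᶜ = computable (pairᵢ a b) λ v → pairᵣ a b (r v) (s v)

  natrecᶜ : ∀ {n} {f t : Vec ℕ n → ℕ} {g : Vec ℕ (2 + n) → ℕ} →
            Computable Z f → Computable Z g → Computable Z t →
            Computable Z (λ v → natrec (f v) (λ i y → g (y ∷ i ∷ v)) (t v))
  natrecᶜ {n} {f} {t} {g} (computable a r) (computable b s) (computable c q) =
    computable (compᵢ (recᵢ a b′) (pairᵢ ⟨ 2 , 0 ⟩ c)) λ v →
      compᵣ _ _ (pairᵣ _ _ iden (q v)) (recᵣ a b′ (f v) _ (r v) (step v) (t v))
    where
    left∘right = compᵢ ⟨ 3 , 0 ⟩ ⟨ 4 , 0 ⟩
    right∘right = compᵢ ⟨ 4 , 0 ⟩ ⟨ 4 , 0 ⟩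
    -- Reassociates the argument `⟨ enc v , ⟨ i , y ⟩ ⟩` of the recursion functional into
    -- `enc (y ∷ i ∷ v)`.
    shuffle = pairᵢ (pairᵢ ⟨ 3 , 0 ⟩ left∘right) right∘right
    b′ = compᵢ b shuffle
    step : ∀ v i y → Φ Z b′ ⟨ enc v , ⟨ i , y ⟩ ⟩ (g (y ∷ i ∷ v))
    step v i y = compᵣ b shuffle
      (pairᵣ _ _
        (pairᵣ _ _ (leftᵣ (enc v) ⟨ i , y ⟩) (compᵣ _ _ (rightᵣ (enc v) ⟨ i , y ⟩) (leftᵣ i y)))
        (compᵣ _ _ (rightᵣ (enc v) ⟨ i , y ⟩) (rightᵣ i y)))
      (s (y ∷ i ∷ v))

  caseᶜ : ∀ {n} {f t : Vec ℕ n → ℕ} {g : Vec ℕ (1 + n) → ℕ} →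
          Computable Z f → Computable Z g → Computable Z t →
          Computable Z (λ v → natrec (f v) (λ i _ → g (i ∷ v)) (t v))
  caseᶜ f g t = natrecᶜ f (g ∘ᶜ tailᶜ) t

  predᶜ : ∀ {n} {f : Vec ℕ n → ℕ} → Computable Z f → Computable Z (λ v → pred (f v))
  predᶜ {f = f} c = cong-comp (λ v → eqn (f v)) (caseᶜ (constᶜ 0) #0 c)
    where
    eqn : ∀ m → natrec 0 (λ i _ → i) m ≡ pred m
    eqn zero    = refl
    eqn (suc _) = refl

  infixl 6 _+ᶜ_ _∸ᶜ_
  infixl 7 _*ᶜ_
  _+ᶜ_ : ∀ {n} {f g : Vec ℕ n → ℕ} → Computable Z f → Computable Z g → Computable Z (λ v → f v + g v)
  _+ᶜ_ {f = f} {g} c d = cong-comp (λ v → eqn (g v) (f v)) (natrecᶜ d (sucᶜ #0) c)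
    where
    eqn : ∀ m k → natrec m (λ _ y → suc y) k ≡ k + m
    eqn m zero    = refl
    eqn m (suc k) = cong suc (eqn m k)

  _*ᶜ_ : ∀ {n} {f g : Vec ℕ n → ℕ} → Computable Z f → Computable Z g → Computable Z (λ v → f v * g v)
  _*ᶜ_ {f = f} {g} c d =
    cong-comp (λ v → eqn (g v) (f v)) (natrecᶜ (constᶜ 0) ((d ∘ᶜ tailᶜ) ∘ᶜ tailᶜ +ᶜ #0) c)
    where
    eqn : ∀ m k → natrec 0 (λ _ y → m + y) k ≡ k * m
    eqn m zero    = refl
    eqn m (suc k) = cong (m +_) (eqn m k)

  _∸ᶜ_ : ∀ {n} {f g : Vec ℕ n → ℕ} → Computable Z f → Computable Z g → Computable Z (λ v → f v ∸ g v)
  _∸ᶜ_ {f = f} {g} c d = cong-comp (λ v → eqn (f v) (g v)) (natrecᶜ c (predᶜ #0) d)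
    where
    eqn : ∀ m k → natrec m (λ _ y → pred y) k ≡ m ∸ k
    eqn m zero    = refl
    eqn m (suc k) = trans (cong pred (eqn m k)) (pred[m∸n]≡m∸[1+n] m k)

-- A test accepts by returning 0, as search does.
record Decidable (Z : 𝟚^ω) {n} (P : Vec ℕ n → Set) : Set where
  constructor decidable
  field
    test     : Vec ℕ n → ℕ
    computes : Computable Z test
    accepts  : ∀ v → test v ≡ 0 ⇔ P v

  decide : ∀ v → Dec (P v)
  decide v with test v ≟ 0
  ... | yes p = yes (to (accepts v) p)
  ... | no ¬p = no λ x → ¬p (from (accepts v) x)

open Decidable

module _ {Z : 𝟚^ω} where

  mapᵈ : ∀ {n} {P Q : Vec ℕ n → Set} → (∀ v → P v ⇔ Q v) → Decidable Z P → Decidable Z Q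
  mapᵈ eqn (decidable t c a) = decidable t c λ v →
    mk⇔ (to (eqn v) ∘ to (a v)) (from (a v) ∘ from (eqn v))

  infixl 9 _∘ᵈ_
  _∘ᵈ_ : ∀ {n k} {P : Vec ℕ k → Set} {F : Vec ℕ n → Vec ℕ k} →
         Decidable Z P → Computables Z F → Decidable Z (λ v → P (F v))
  decidable t c a ∘ᵈ F = decidable _ (c ∘ᶜ F) λ v → a _

  module _ {n} {f g : Vec ℕ n → ℕ} where

    infix 4 _≤ᵈ_ _≡ᵈ_
    _≤ᵈ_ : Computable Z f → Computable Z g → Decidable Z (λ v → f v ≤ g v)
    c ≤ᵈ d = decidable _ (c ∸ᶜ d) λ v → mk⇔ m∸n≡0⇒m≤n m≤n⇒m∸n≡0

    _≡ᵈ_ : Computable Z f → Computable Z g → Decidable Z (λ v → f v ≡ g v)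
    c ≡ᵈ d = decidable _ ((c ∸ᶜ d) +ᶜ (d ∸ᶜ c)) λ v → mk⇔
      (λ p → ≤-antisym (m∸n≡0⇒m≤n (m+n≡0⇒m≡0 _ p)) (m∸n≡0⇒m≤n (m+n≡0⇒n≡0 (f v ∸ g v) p)))
      (λ p → cong₂ _+_ (m≤n⇒m∸n≡0 (≤-reflexive p)) (m≤n⇒m∸n≡0 (≤-reflexive (sym p))))

  infix 4 _<ᵈ_
  _<ᵈ_ : ∀ {n} {f g : Vec ℕ n → ℕ} → Computable Z f → Computable Z g → Decidable Z (λ v → f v < g v)
  c <ᵈ d = sucᶜ c ≤ᵈ d

  module _ {n} {P : Vec ℕ n → Set} where

    ¬ᵈ_ : Decidable Z P → Decidable Z (λ v → ¬ P v)
    ¬ᵈ decidable t c a = decidable _ (constᶜ 1 ∸ᶜ c) λ v → mk⇔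
      (λ q p → reject (t v) q (from (a v) p))
      (λ ¬p → accept (t v) λ q → ¬p (to (a v) q))
      where
      reject : ∀ m → 1 ∸ m ≡ 0 → m ≢ 0
      reject (suc m) _ ()
      accept : ∀ m → m ≢ 0 → 1 ∸ m ≡ 0
      accept zero    p = ⊥-elim (p refl)
      accept (suc m) p = 0∸n≡0 m

    module _ {Q : Vec ℕ n → Set} where

      infixr 3 _×ᵈ_
      infixr 2 _⊎ᵈ_
      _×ᵈ_ : Decidable Z P → Decidable Z Q → Decidable Z (λ v → P v × Q v)
      decidable s c a ×ᵈ decidable t d b = decidable _ (c +ᶜ d) λ v → mk⇔
        (λ p → to (a v) (m+n≡0⇒m≡0 _ p) , to (b v) (m+n≡0⇒n≡0 (s v) p))
        (λ { (p , q) → cong₂ _+_ (from (a v) p) (from (b v) q) })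

      _⊎ᵈ_ : Decidable Z P → Decidable Z Q → Decidable Z (λ v → P v ⊎ Q v)
      decidable s c a ⊎ᵈ decidable t d b = decidable _ (c *ᶜ d) λ v → mk⇔
        (λ p → [ inj₁ ∘ to (a v) , inj₂ ∘ to (b v) ]′ (m*n≡0⇒m≡0∨n≡0 (s v) p))
        [ (λ p → cong (_* t v) (from (a v) p))
        , (λ q → trans (cong (s v *_) (from (b v) q)) (*-zeroʳ (s v))) ]′

  infixr 2 _→ᵈ_
  _→ᵈ_ : ∀ {n} {P Q : Vec ℕ n → Set} → Decidable Z P → Decidable Z Q → Decidable Z (λ v → P v → Q v)
  _→ᵈ_ {P = P} {Q} p q = mapᵈ (λ v → mk⇔ (go v) (back v)) (¬ᵈ p ⊎ᵈ q)
    where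
    go : ∀ v → ¬ P v ⊎ Q v → P v → Q v
    go v (inj₁ ¬p) x = ⊥-elim (¬p x)
    go v (inj₂ y)  x = y
    back : ∀ v → (P v → Q v) → ¬ P v ⊎ Q v
    back v h with decide p v
    ... | yes x = inj₂ (h x)
    ... | no ¬x = inj₁ ¬x

  -- A sum of tests vanishes exactly when every summand does; the empty sum accepts.
  ∀<ᵈ : ∀ {n} {t : Vec ℕ n → ℕ} {P : Vec ℕ (suc n) → Set} → Computable Z t → Decidable Z P →
        Decidable Z (λ v → ∀ i → i < t v → P (i ∷ v))
  ∀<ᵈ {n} {t} {P} c (decidable s d a) =
    decidable _ (natrecᶜ (constᶜ 0) (#0 +ᶜ d ∘ᶜ tailᶜ) c) λ v → mk⇔
      (λ p i i<t → to (a _) (out v (t v) p i i<t)) (λ h → into v (t v) λ i i<t → from (a _) (h i i<t))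
    where
    total : Vec ℕ n → ℕ → ℕ
    total v = natrec 0 (λ i y → y + s (i ∷ v))
    out : ∀ v k → total v k ≡ 0 → ∀ i → i < k → s (i ∷ v) ≡ 0
    out v (suc k) p i i<k with m<1+n⇒m<n∨m≡n i<k
    ... | inj₁ q    = out v k (m+n≡0⇒m≡0 _ p) i q
    ... | inj₂ refl = m+n≡0⇒n≡0 (total v k) p
    into : ∀ v k → (∀ i → i < k → s (i ∷ v) ≡ 0) → total v k ≡ 0
    into v zero    h = refl
    into v (suc k) h = cong₂ _+_ (into v k λ i q → h i (m<n⇒m<1+n q)) (h k (n<1+n k))

  -- Dually, a product of tests vanishes exactly when some factor does; the empty product is 1 and
  -- rejects.
  ∃<ᵈ : ∀ {n} {t : Vec ℕ n → ℕ} {P : Vec ℕ (suc n) → Set} → Computable Z t → Decidable Z P →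
        Decidable Z (λ v → ∃[ i ] i < t v × P (i ∷ v))
  ∃<ᵈ {n} {t} {P} c (decidable s d a) =
    decidable _ (natrecᶜ (constᶜ 1) (#0 *ᶜ d ∘ᶜ tailᶜ) c) λ v → mk⇔
      (λ p → let i , i<t , q = out v (t v) p in i , i<t , to (a _) q)
      (λ { (i , i<t , q) → into v (t v) i i<t (from (a _) q) })
    where
    total : Vec ℕ n → ℕ → ℕ
    total v = natrec 1 (λ i y → y * s (i ∷ v))
    out : ∀ v k → total v k ≡ 0 → ∃[ i ] i < k × s (i ∷ v) ≡ 0
    out v (suc k) p with m*n≡0⇒m≡0∨n≡0 (total v k) p
    ... | inj₁ q = let i , i<k , r = out v k q in i , m<n⇒m<1+n i<k , r
    ... | inj₂ q = k , n<1+n k , q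
    into : ∀ v k i → i < k → s (i ∷ v) ≡ 0 → total v k ≡ 0
    into v (suc k) i i<k p with m<1+n⇒m<n∨m≡n i<k
    ... | inj₁ q    = cong (_* s (k ∷ v)) (into v k i q p)
    ... | inj₂ refl = trans (cong (total v k *_) p) (*-zeroʳ (total v k))

  -- The index depends on the test alone. The witnesses given by the hypothesis only show that the
  -- search ends, so they may come from excluded middle.
  search : ∀ {n} {P : Vec ℕ (suc n) → Set} → Decidable Z P → (∀ v → ∃[ p ] P (p ∷ v)) →
           ∃[ f ] Computable Z f × (∀ v → P (f v ∷ v))
  search {n} {P} (decidable t (computable e r) a) h =
      (λ v → proj₁ (found v))
    , computable (compᵢ (searchᵢ e) (pairᵢ ⟨ 2 , 0 ⟩ ⟨ 0 , 0 ⟩))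
        (λ v → compᵣ _ _ (pairᵣ _ _ iden zer) (proj₂ (proj₂ (found v))))
    , (λ v → to (a _) (proj₁ (proj₂ (found v))))
    where
    found : ∀ v → ∃[ p ] t (p ∷ v) ≡ 0 × Φ Z (searchᵢ e) ⟨ enc v , 0 ⟩ p
    found v = let p , q = h v in
      searchᵣ (enc v) e (λ p → t (p ∷ v)) (λ p → r (p ∷ v)) p 0
        (trans (cong (λ i → t (i ∷ v)) (+-identityʳ p)) (from (a _) q))

  -- Replaces a program for `f` by a search for its value; square root and halving then need only
  -- the inequalities that characterise them.
  from-graph : ∀ {n} (f : Vec ℕ n → ℕ) → Decidable Z {suc n} (λ v → head v ≡ f (tail v)) → Computable Z f
  from-graph f d = let g , c , eqn = search d (λ v → f v , refl) in cong-comp eqn c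

  rootᶜ : ∀ {n} {f : Vec ℕ n → ℕ} → Computable Z f → Computable Z (λ v → root (f v))
  rootᶜ {f = f} c = from-graph (λ v → root (f v))
    (mapᵈ (λ { (s ∷ v) → mk⇔ (λ (lo , up) → root-unique lo up)
                             (λ { refl → root-lower (f v) , root-upper (f v) }) })
      ((#0 *ᶜ #0 ≤ᵈ c ∘ᶜ tailᶜ) ×ᵈ (c ∘ᶜ tailᶜ <ᵈ sucᶜ #0 *ᶜ sucᶜ #0)))

  π₁ᶜ : ∀ {n} {f : Vec ℕ n → ℕ} → Computable Z f → Computable Z (λ v → π₁ (f v))
  π₁ᶜ c = c ∸ᶜ rootᶜ c *ᶜ rootᶜ c

  π₂ᶜ : ∀ {n} {f : Vec ℕ n → ℕ} → Computable Z f → Computable Z (λ v → π₂ (f v))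
  π₂ᶜ c = rootᶜ c ∸ᶜ π₁ᶜ c

module _ {A : Set} (d : A) (k : ℕ → ℕ → A) where

  abstract
    -- Pairing is not surjective, so case analysis on a pair carries a default `d` for all other
    -- numbers.
    unpair : ℕ → A
    unpair n with ⟨ π₁ n , π₂ n ⟩ ≟ n
    ... | yes _ = k (π₁ n) (π₂ n)
    ... | no  _ = d

    unpair-yes : ∀ n → ⟨ π₁ n , π₂ n ⟩ ≡ n → unpair n ≡ k (π₁ n) (π₂ n)
    unpair-yes n p with ⟨ π₁ n , π₂ n ⟩ ≟ n
    ... | yes _ = refl
    ... | no ¬p = ⊥-elim (¬p p)

    unpair-no : ∀ n → ⟨ π₁ n , π₂ n ⟩ ≢ n → unpair n ≡ d
    unpair-no n ¬p with ⟨ π₁ n , π₂ n ⟩ ≟ n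
    ... | yes p = ⊥-elim (¬p p)
    ... | no  _ = refl

    unpair-⟨⟩ : ∀ p q → unpair ⟨ p , q ⟩ ≡ k p q
    unpair-⟨⟩ p q = trans (unpair-yes ⟨ p , q ⟩ (cong₂ ⟨_,_⟩ (π₁-⟨⟩ p q) (π₂-⟨⟩ p q)))
                          (cong₂ k (π₁-⟨⟩ p q) (π₂-⟨⟩ p q))

  data Unpaired : ℕ → Set where
    paired   : ∀ p q → unpair ⟨ p , q ⟩ ≡ k p q → Unpaired ⟨ p , q ⟩
    unpaired : ∀ {n} → unpair n ≡ d → Unpaired n

  unpair-view : ∀ n → Unpaired n
  unpair-view n = go (⟨ π₁ n , π₂ n ⟩ ≟ n)
    where
    go : Dec (⟨ π₁ n , π₂ n ⟩ ≡ n) → Unpaired n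
    go (yes p) = subst Unpaired p (paired (π₁ n) (π₂ n) (unpair-⟨⟩ (π₁ n) (π₂ n)))
    go (no ¬p) = unpaired (unpair-no n ¬p)

module _ {Z : 𝟚^ω} where

  unpairᶜ : ∀ {n} {f : Vec ℕ n → ℕ} {g : Vec ℕ (2 + n) → ℕ} → Computable Z f → Computable Z g →
            Computable Z (λ v → unpair 0 (λ p q → g (q ∷ p ∷ v)) (f v))
  unpairᶜ {n} {f} {g} c d = from-graph _
    (mapᵈ (λ { (y ∷ v) → mk⇔ (go y v) (back y v) })
      ((isPair ×ᵈ (#0 ≡ᵈ d ∘ᶜ (π₂ᶜ c′ ∷ᶜ π₁ᶜ c′ ∷ᶜ tailᶜ))) ⊎ᵈ (¬ᵈ isPair ×ᵈ (#0 ≡ᵈ constᶜ 0))))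
    where
    c′ : Computable Z {suc n} (λ v → f (tail v))
    c′ = c ∘ᶜ tailᶜ
    isPair : Decidable Z {suc n} (λ v → ⟨ π₁ (f (tail v)) , π₂ (f (tail v)) ⟩ ≡ f (tail v))
    isPair = ⟨ π₁ᶜ c′ , π₂ᶜ c′ ⟩ᶜ ≡ᵈ c′
    K : Vec ℕ n → ℕ → ℕ → ℕ
    K v p q = g (q ∷ p ∷ v)
    go : ∀ y v → _ → y ≡ unpair 0 (K v) (f v)
    go y v (inj₁ (p , eqn)) = trans eqn (sym (unpair-yes 0 (K v) (f v) p))
    go y v (inj₂ (¬p , eqn)) = trans eqn (sym (unpair-no 0 (K v) (f v) ¬p))
    back : ∀ y v → y ≡ unpair 0 (K v) (f v) → _
    back y v eqn with ⟨ π₁ (f v) , π₂ (f v) ⟩ ≟ f v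
    ... | yes p = inj₁ (p , trans eqn (unpair-yes 0 (K v) (f v) p))
    ... | no ¬p = inj₂ (¬p , trans eqn (unpair-no 0 (K v) (f v) ¬p))

-- Evaluation with fuel

data Code : Set where
  nowhere zeroᶠ sucᶠ idᶠ leftᶠ rightᶠ queryᶠ : Code
  pairᶠ compᶠ recᶠ : Code → Code → Code
  searchᶠ : Code → Code

atom : Code → ℕ → Code
atom c zero    = c
atom c (suc _) = nowhere

-- The first argument only bounds the depth of the decoding.
decode : ℕ → ℕ → Code
op     : ℕ → ℕ → ℕ → Code
decode zero    e = nowhere
decode (suc d) e = unpair nowhere (op d) e
op d 0 = atom zeroᶠ
op d 1 = atom sucᶠ
op d 2 = atom idᶠ
op d 3 = atom leftᶠ
op d 4 = atom rightᶠ
op d 5 = atom queryᶠ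
op d 6 = unpair nowhere λ a b → pairᶠ (decode d a) (decode d b)
op d 7 = unpair nowhere λ a b → compᶠ (decode d a) (decode d b)
op d 8 = unpair nowhere λ a b → recᶠ (decode d a) (decode d b)
op d 9 = λ a → searchᶠ (decode d a)
op d _ = λ _ → nowhere

bind : ℕ → (ℕ → ℕ) → ℕ
bind r k = natrec 0 (λ y _ → k y) r

bind-inv : ∀ r k {z} → bind r k ≡ suc z → ∃[ y ] r ≡ suc y × k y ≡ suc z
bind-inv (suc y) k p = y , refl , p

-- The state of a scan is 0 while it is running, 1 once it is stuck on an
-- undefined value, and suc (suc p) once the zero p is found.
verdict : ℕ → ℕ → ℕ
verdict p r = natrec 1 (λ r′ _ → natrec (suc (suc p)) (λ _ _ → 0) r′) r

-- Bounded search by primitive recursion. Positions `p` below the start `n`, recognised by `n ∸ p`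
-- being nonzero, are passed over, and a nonzero state is final.
scan : (ℕ → ℕ) → ℕ → ℕ → ℕ
scan t n i = natrec 0 (λ p st → natrec (natrec (verdict p (t p)) (λ _ _ → 0) (n ∸ p)) (λ k _ → suc k) st) i

iter : ℕ → (ℕ → ℕ → ℕ) → ℕ → ℕ
iter z g n = natrec z (λ i r → bind r (g i)) n

-- The value is 0 for "undefined" and suc y for y. The fuel s only bounds the
-- searches, so no step counting is needed.
ev : Code → 𝟚^ω → ℕ → ℕ → ℕ
ev nowhere       O s x = 0
ev zeroᶠ         O s x = 1
ev sucᶠ          O s x = suc (suc x)
ev idᶠ           O s x = suc x
ev leftᶠ         O s x = unpair 0 (λ p q → suc p) x
ev rightᶠ        O s x = unpair 0 (λ p q → suc q) x
ev queryᶠ        O s x = suc (χ O x)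
ev (pairᶠ a b)   O s x = bind (ev a O s x) λ y → bind (ev b O s x) λ z → suc ⟨ y , z ⟩
ev (compᶠ a b)   O s x = bind (ev b O s x) λ y → ev a O s y
ev (recᶠ a b)    O s u = unpair 0 (λ x n → iter (ev a O s x) (λ i y → ev b O s ⟨ x , ⟨ i , y ⟩ ⟩) n) u
ev (searchᶠ a)   O s u = unpair 0 (λ x n → pred (scan (λ p → ev a O s ⟨ x , p ⟩) n s)) u

module _ (t : ℕ → ℕ) where

  scan-step : ∀ n p {st} → scan t n p ≡ st →
    scan t n (suc p) ≡ natrec (natrec (verdict p (t p)) (λ _ _ → 0) (n ∸ p)) (λ k _ → suc k) st
  scan-step n p refl = refl

  scan-below : ∀ n i → i ≤ n → scan t n i ≡ 0
  scan-below n zero i≤n = refl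
  scan-below n (suc i) i<n = trans (scan-step n i (scan-below n i (<⇒≤ i<n))) (lemma (n ∸ i) (m>n⇒m∸n≢0 i<n))
    where
    lemma : ∀ m → m ≢ 0 → natrec (verdict i (t i)) (λ _ _ → 0) m ≡ 0
    lemma zero    p = ⊥-elim (p refl)
    lemma (suc m) p = refl

  scan-test : ∀ n p → scan t n p ≡ 0 → n ≤ p → scan t n (suc p) ≡ verdict p (t p)
  scan-test n p run n≤p =
    trans (scan-step n p run) (cong (natrec (verdict p (t p)) (λ _ _ → 0)) (m≤n⇒m∸n≡0 n≤p))

  scan-stop : ∀ n i → t n ≡ 1 → n < i → scan t n i ≡ suc (suc n)
  scan-stop n (suc i) hit n<i with m<1+n⇒m<n∨m≡n n<i
  ... | inj₁ n<i′ = scan-step n i (scan-stop n i hit n<i′)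
  ... | inj₂ refl = trans (scan-test n n (scan-below n n ≤-refl) ≤-refl) (cong (verdict n) hit)

  -- At position `n` both scans keep running, one because its test fails and the other because it
  -- skips; elsewhere they act alike. This is the counterpart of the clause `next`.
  scan-next : ∀ n {y} → t n ≡ suc (suc y) → ∀ i → scan t n i ≡ scan t (suc n) i
  scan-next n miss zero = refl
  scan-next n miss (suc i) with scan t n i in eqn₁ | scan t (suc n) i in eqn₂ | scan-next n miss i
  ... | suc _ | suc _ | refl = refl
  ... | zero  | zero  | refl with <-cmp i n
  ...   | tri< i<n _ _ = trans (sym (scan-step n i eqn₁)) (trans (scan-below n (suc i) i<n)
                           (trans (sym (scan-below (suc n) (suc i) (m<n⇒m<1+n i<n))) (scan-step (suc n) i eqn₂)))
  ...   | tri≈ _ refl _ = trans (sym (scan-step n i eqn₁)) (trans (scan-test n n eqn₁ ≤-refl)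
                            (trans (cong (verdict n) miss)
                              (trans (sym (scan-below (suc n) (suc n) ≤-refl)) (scan-step (suc n) n eqn₂))))
  ...   | tri> _ _ n<i = trans (sym (scan-step n i eqn₁)) (trans (scan-test n i eqn₁ (<⇒≤ n<i))
                           (trans (sym (scan-test (suc n) i eqn₂ n<i)) (scan-step (suc n) i eqn₂)))

  module _ (S : ℕ → ℕ → Set) (stopS : ∀ p → t p ≡ 1 → S p p)
           (nextS : ∀ p y z → t p ≡ suc (suc y) → S (suc p) z → S p z) (n : ℕ) where

    -- While the scan runs, every tested position was a defined nonzero value, so `nextS` carries a
    -- result at the current position back to the start. The maximum accounts for the positions
    -- below `n`, where nothing has been tested.
    scan-running : ∀ i → scan t n i ≡ 0 → ∀ z → S (n ⊔ i) z → S n z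
    scan-running zero    run z p = subst (λ k → S k z) (⊔-identityʳ n) p
    scan-running (suc i) run z p with scan t n i in eqn
    ... | zero with n ≤? i
    ...   | no n≰i = scan-running i eqn z
              (subst (λ k → S k z) (trans (m≥n⇒m⊔n≡m (≰⇒> n≰i)) (sym (m≥n⇒m⊔n≡m (<⇒≤ (≰⇒> n≰i))))) p)
    ...   | yes n≤i rewrite m≤n⇒m∸n≡0 n≤i with t i in hit
    ...     | suc (suc y) = scan-running i eqn z
              (subst (λ k → S k z) (sym (m≤n⇒m⊔n≡n n≤i))
                (nextS i y z hit (subst (λ k → S k z) (m≤n⇒m⊔n≡n (m≤n⇒m≤1+n n≤i)) p)))

    scan-found : ∀ i z → scan t n i ≡ suc (suc z) → S n z
    scan-found (suc i) z found with scan t n i in eqn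
    ... | suc _ = scan-found i z (trans eqn found)
    ... | zero with n ≤? i
    ...   | no n≰i with () ← trans (sym (scan-below n (suc i) (≰⇒> n≰i))) (trans (scan-step n i eqn) found)
    ...   | yes n≤i rewrite m≤n⇒m∸n≡0 n≤i with t i in hit
    ...     | suc zero with refl ← found =
              scan-running i eqn i (subst (λ k → S k i) (sym (m≤n⇒m⊔n≡n n≤i)) (stopS i hit))

-- Asking for all large fuels lets the fuels of subcomputations be merged by a maximum, without
-- monotonicity of `ev`.
Eventually : (ℕ → Set) → Set
Eventually P = ∃[ s ] ∀ s′ → s ≤ s′ → P s′

always : ∀ {P : ℕ → Set} → (∀ s → P s) → Eventually P
always h = 0 , λ s _ → h s

both : ∀ {P Q R : ℕ → Set} → (∀ {s} → P s → Q s → R s) → Eventually P → Eventually Q → Eventually R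
both f (s , p) (t , q) = s ⊔ t , λ u le → f (p u (m⊔n≤o⇒m≤o s t le)) (q u (m⊔n≤o⇒n≤o s t le))

module _ {O : 𝟚^ω} where

  -- A depth that is too small only turns subprograms into `nowhere`: values may be lost, but none
  -- is wrong.
  ev-sound : ∀ d e {s x y} → ev (decode d e) O s x ≡ suc y → Φ O e x y
  ev-sound zero e ()
  ev-sound (suc d) e {s} {x} {y} p with unpair-view nowhere (op d) e
  ... | unpaired eqn rewrite eqn with () ← p
  ... | paired tag q eqn rewrite eqn = go tag q p
    where
    go : ∀ tag q → ev (op d tag q) O s x ≡ suc y → Φ O ⟨ tag , q ⟩ x y
    go 0 0 refl = zer
    go 1 0 refl = subst (Φ O ⟨ 1 , 0 ⟩ x) (+-comm x 1) succ
    go 2 0 refl = iden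
    go 3 0 p with unpair-view 0 (λ p q → suc p) x
    ... | paired l r eqn with refl ← trans (sym eqn) p = left {x = l} {r}
    ... | unpaired eqn with () ← trans (sym eqn) p
    go 4 0 p with unpair-view 0 (λ p q → suc q) x
    ... | paired l r eqn with refl ← trans (sym eqn) p = right {x = l} {r}
    ... | unpaired eqn with () ← trans (sym eqn) p
    go 5 0 refl = query
    go 6 q p with unpair-view nowhere (λ a b → pairᶠ (decode d a) (decode d b)) q
    ... | unpaired eqn rewrite eqn with () ← p
    ... | paired a b eqn rewrite eqn
      with y₁ , p₁ , p′ ← bind-inv (ev (decode d a) O s x) _ p
      with y₂ , p₂ , refl ← bind-inv (ev (decode d b) O s x) _ p′ =
      pair {a = a} {b} (ev-sound d a p₁) (ev-sound d b p₂)
    go 7 q p with unpair-view nowhere (λ a b → compᶠ (decode d a) (decode d b)) q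
    ... | unpaired eqn rewrite eqn with () ← p
    ... | paired a b eqn rewrite eqn
      with y₁ , p₁ , p₂ ← bind-inv (ev (decode d b) O s x) _ p =
      comp {a = a} {b} (ev-sound d b p₁) (ev-sound d a p₂)
    go 8 q p with unpair-view nowhere (λ a b → recᶠ (decode d a) (decode d b)) q
    ... | unpaired eqn rewrite eqn with () ← p
    ... | paired a b eqn rewrite eqn
      with unpair-view 0 (λ x n → iter (ev (decode d a) O s x) (λ i y → ev (decode d b) O s ⟨ x , ⟨ i , y ⟩ ⟩) n) x
    ...   | unpaired eqn′ with () ← trans (sym eqn′) p
    ...   | paired x n eqn′ = loop n (trans (sym eqn′) p)
      where
      loop : ∀ n {y} → iter (ev (decode d a) O s x) (λ i y → ev (decode d b) O s ⟨ x , ⟨ i , y ⟩ ⟩) n ≡ suc y →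
             Φ O ⟨ 8 , ⟨ a , b ⟩ ⟩ ⟨ x , n ⟩ y
      loop zero p = rec₀ {a = a} {b} {x} (ev-sound d a p)
      loop (suc n) {z} p
        with y , p₁ , p₂ ← bind-inv (iter (ev (decode d a) O s x) _ n) _ p =
        subst (λ i → Φ O ⟨ 8 , ⟨ a , b ⟩ ⟩ ⟨ x , i ⟩ z) (+-comm n 1)
          (rec₊ {a = a} {b} {x} {n} {y} (loop n p₁) (ev-sound d b p₂))
    go 9 a p with unpair-view 0 (λ x n → pred (scan (λ p → ev (decode d a) O s ⟨ x , p ⟩) n s)) x
    ... | unpaired eqn with () ← trans (sym eqn) p
    ... | paired x n eqn = scan-found (λ p → ev (decode d a) O s ⟨ x , p ⟩) (λ p → Φ O ⟨ 9 , a ⟩ ⟨ x , p ⟩)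
      (λ p h → stop {a = a} {x} {p} (ev-sound d a h))
      (λ p y z h φ → next {a = a} {x} {p} {y}
        (subst (Φ O a ⟨ x , p ⟩) (+-comm 1 y) (ev-sound d a h))
        (subst (λ i → Φ O ⟨ 9 , a ⟩ ⟨ x , i ⟩ z) (+-comm 1 p) φ))
      n s y (unpred (trans (sym eqn) p))
      where
      unpred : ∀ {m k} → pred m ≡ suc k → m ≡ suc (suc k)
      unpred {suc m} refl = refl

  tag-decode : ∀ d {tag q s x r} → ev (op d tag q) O s x ≡ r → ev (decode (suc d) ⟨ tag , q ⟩) O s x ≡ r
  tag-decode d {tag} {q} {s} {x} = trans (cong (λ c → ev c O s x) (unpair-⟨⟩ nowhere (op d) tag q))

  tag-decode₂ : ∀ d {tag a b s x r} (k : Code → Code → Code) →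
    op d tag ≡ unpair nowhere (λ a b → k (decode d a) (decode d b)) →
    ev (k (decode d a) (decode d b)) O s x ≡ r → ev (decode (suc d) ⟨ tag , ⟨ a , b ⟩ ⟩) O s x ≡ r
  tag-decode₂ d {tag} {a} {b} {s} {x} k eqn p = tag-decode d {tag} {⟨ a , b ⟩}
    (trans (cong (λ c → ev c O s x) (trans (cong (λ f → f ⟨ a , b ⟩) eqn) (unpair-⟨⟩ _ _ a b))) p)

  -- Components of a compound index are strictly smaller than it because its tag is positive, so
  -- depth `suc e` decodes `e` completely.
  arg₂< : ∀ tag q {d} → 0 < tag → ⟨ tag , q ⟩ < suc d → q < d
  arg₂< tag q 0<tag (s≤s le) = ≤-trans (+-monoˡ-≤ q 0<tag) (≤-trans (+≤⟨⟩ tag q) le)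

  arg₂₁< : ∀ tag a b {d} → 0 < tag → ⟨ tag , ⟨ a , b ⟩ ⟩ < suc d → a < d
  arg₂₁< tag a b 0<tag le = ≤-<-trans (≤⟨⟩₁ a b) (arg₂< tag ⟨ a , b ⟩ 0<tag le)

  arg₂₂< : ∀ tag a b {d} → 0 < tag → ⟨ tag , ⟨ a , b ⟩ ⟩ < suc d → b < d
  arg₂₂< tag a b 0<tag le = ≤-<-trans (≤⟨⟩₂ a b) (arg₂< tag ⟨ a , b ⟩ 0<tag le)

  -- Induction on the derivation rather than on the depth: in `rec₊` and `next` one premise has the
  -- same index as the conclusion.
  ev-complete : ∀ {e x y} → Φ O e x y → ∀ d → e < d → Eventually (λ s → ev (decode d e) O s x ≡ suc y)
  ev-complete zer   (suc d) _ = always λ s → tag-decode d {0} {0} refl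
  ev-complete {x = x} succ  (suc d) _ = always λ s → tag-decode d {1} {0} (cong suc (+-comm 1 x))
  ev-complete iden  (suc d) _ = always λ s → tag-decode d {2} {0} refl
  ev-complete (left {x} {y})  (suc d) _ = always λ s → tag-decode d {3} {0} {s} {⟨ x , y ⟩} (unpair-⟨⟩ 0 (λ p q → suc p) x y)
  ev-complete (right {x} {y}) (suc d) _ = always λ s → tag-decode d {4} {0} {s} {⟨ x , y ⟩} (unpair-⟨⟩ 0 (λ p q → suc q) x y)
  ev-complete query (suc d) _ = always λ s → tag-decode d {5} {0} refl
  ev-complete (pair {a} {b} {x} {y} {z} φ ψ) (suc d) le = both
    (λ {s} p q → tag-decode₂ d {6} {a} {b} {s} {x} pairᶠ refl (bind₂ p q))
    (ev-complete φ d (arg₂₁< 6 a b (s≤s z≤n) le)) (ev-complete ψ d (arg₂₂< 6 a b (s≤s z≤n) le))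
    where
    bind₂ : ∀ {m n} → m ≡ suc y → n ≡ suc z → bind m (λ y → bind n λ z → suc ⟨ y , z ⟩) ≡ suc ⟨ y , z ⟩
    bind₂ refl refl = refl
  ev-complete (comp {a} {b} {x} {y} {z} φ ψ) (suc d) le = both
    (λ {s} p q → tag-decode₂ d {7} {a} {b} {s} {x} compᶠ refl
      (trans (cong (λ m → bind m (ev (decode d a) O s)) p) q))
    (ev-complete φ d (arg₂₂< 7 a b (s≤s z≤n) le)) (ev-complete ψ d (arg₂₁< 7 a b (s≤s z≤n) le))
  ev-complete (rec₀ {a} {b} {x} φ) (suc d) le with ev-complete φ d (arg₂₁< 8 a b (s≤s z≤n) le)
  ... | s , h = s , λ s′ le′ → tag-decode₂ d {8} {a} {b} {s′} {⟨ x , 0 ⟩} recᶠ refl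
    (trans (unpair-⟨⟩ 0 _ x 0) (h s′ le′))
  ev-complete (rec₊ {a} {b} {x} {n} {y} {z} φ ψ) (suc d) le = both
    (λ {s} p q → tag-decode₂ d {8} {a} {b} {s} {⟨ x , n + 1 ⟩} recᶠ refl
      (trans (unpair-⟨⟩ 0 _ x (n + 1)) (trans (cong (loop s) (+-comm n 1))
        (trans (cong (λ m → bind m (λ y → ev (decode d b) O s ⟨ x , ⟨ n , y ⟩ ⟩))
          (trans (sym (unpair-⟨⟩ 0 _ x n)) (trans (sym (tag-decode₂ d {8} {a} {b} {s} {⟨ x , n ⟩} recᶠ refl refl)) p))) q))))
    (ev-complete φ (suc d) le) (ev-complete ψ d (arg₂₂< 8 a b (s≤s z≤n) le))
    where
    loop : ℕ → ℕ → ℕ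
    loop s = iter (ev (decode d a) O s x) (λ i y → ev (decode d b) O s ⟨ x , ⟨ i , y ⟩ ⟩)
  ev-complete (stop {a} {x} {n} φ) (suc d) le = both
    (λ {s} p n<s → tag-decode d {9} {a} {s} {⟨ x , n ⟩}
      (trans (unpair-⟨⟩ 0 _ x n) (cong pred (scan-stop (λ p → ev (decode d a) O s ⟨ x , p ⟩) n s p n<s))))
    -- The scan tests position `n` only if the fuel exceeds `n`.
    (ev-complete φ d (arg₂< 9 a (s≤s z≤n) le)) (suc n , λ s n<s → n<s)
  ev-complete (next {a} {x} {n} {y} {z} φ ψ) (suc d) le = both
    (λ {s} p q → tag-decode d {9} {a} {s} {⟨ x , n ⟩}
      (trans (unpair-⟨⟩ 0 _ x n)
        (trans (cong pred (trans
          (scan-next (λ p → ev (decode d a) O s ⟨ x , p ⟩) n (trans p (cong suc (+-comm y 1))) s)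
          (cong (λ i → scan (λ p → ev (decode d a) O s ⟨ x , p ⟩) i s) (+-comm 1 n))))
          (trans (sym (unpair-⟨⟩ 0 _ x (n + 1)))
            (trans (sym (tag-decode d {9} {a} {s} {⟨ x , n + 1 ⟩} refl)) q)))))
    (ev-complete φ d (arg₂< 9 a (s≤s z≤n) le)) (ev-complete ψ (suc d) le)

-- The evaluator is a function, and at a sufficiently large fuel it returns both values.
Φ-functional : ∀ {X e x y z} → Φ X e x y → Φ X e x z → y ≡ z
Φ-functional {e = e} φ ψ with both (λ p q → suc-injective (trans (sym p) q))
                              (ev-complete φ (suc e) ≤-refl) (ev-complete ψ (suc e) ≤-refl)
... | s , h = h s ≤-refl

-- Evaluation over uniformly decidable families of oracles

Family : ℕ → Set
Family k = Vec ℕ k → 𝟚^ω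

DecidableFamily : 𝟚^ω → ∀ {k} → Family k → Set
DecidableFamily Z X = Decidable Z (λ v → X (tail v) (head v) ≡ true)

χᶜ : ∀ {Z k} (X : Family k) → DecidableFamily Z X → Computable Z (λ v → χ (X (tail v)) (head v))
χᶜ X (decidable t c a) = cong-comp (λ v → lemma (t v) (X (tail v) (head v)) (a v)) (constᶜ 1 ∸ᶜ c)
  where
  lemma : ∀ m b → m ≡ 0 ⇔ b ≡ true → 1 ∸ m ≡ (if b then 1 else 0)
  lemma zero    true  h = refl
  lemma zero    false h with () ← to h refl
  lemma (suc m) true  h with () ← from h refl
  lemma (suc m) false h = 0∸n≡0 m

module _ {Z : 𝟚^ω} {k} {O : Family k} (Oᵈ : DecidableFamily Z O) where

  -- The environment holds the input, the fuel and then the oracle parameters. Since `c` is fixed,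
  -- recursion on it assembles the index clause by clause.
  evᶜ : ∀ c → Computable Z (λ v → ev c (O (drop 2 v)) (lookup v (# 1)) (lookup v (# 0)))
  evᶜ nowhere     = constᶜ 0
  evᶜ zeroᶠ       = constᶜ 1
  evᶜ sucᶠ        = sucᶜ (sucᶜ #0)
  evᶜ idᶠ         = sucᶜ #0
  evᶜ leftᶠ       = unpairᶜ #0 (sucᶜ #1)
  evᶜ rightᶠ      = unpairᶜ #0 (sucᶜ #0)
  evᶜ queryᶠ      = sucᶜ (χᶜ O Oᵈ ∘ᶜ (#0 ∷ᶜ dropᶜ 2))
  evᶜ (pairᶠ a b) = caseᶜ (constᶜ 0) (caseᶜ (constᶜ 0) (sucᶜ ⟨ #1 , #0 ⟩ᶜ) (evᶜ b ∘ᶜ tailᶜ)) (evᶜ a)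
  evᶜ (compᶠ a b) = caseᶜ (constᶜ 0) (evᶜ a ∘ᶜ (#0 ∷ᶜ #2 ∷ᶜ dropᶜ 3)) (evᶜ b)
  evᶜ (recᶠ a b)  = unpairᶜ #0 (natrecᶜ (evᶜ a ∘ᶜ (#1 ∷ᶜ varᶜ (# 3) ∷ᶜ dropᶜ 4))
    (caseᶜ (constᶜ 0) (evᶜ b ∘ᶜ (⟨ varᶜ (# 4) , ⟨ #2 , #0 ⟩ᶜ ⟩ᶜ ∷ᶜ varᶜ (# 6) ∷ᶜ dropᶜ 7)) #0) #0)
  evᶜ (searchᶠ a) = unpairᶜ #0 (predᶜ (natrecᶜ (constᶜ 0)
    -- Inside the scan the environment is: state, position, start, parameter `x`, input, fuel,
    -- oracle parameters.
    (caseᶜ (caseᶜ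
      (caseᶜ (constᶜ 1) (caseᶜ (sucᶜ (sucᶜ #2)) (constᶜ 0) #0)
        (evᶜ a ∘ᶜ (⟨ varᶜ (# 3) , #1 ⟩ᶜ ∷ᶜ varᶜ (# 5) ∷ᶜ dropᶜ 6)))
      (constᶜ 0) (#2 ∸ᶜ #1)) (sucᶜ #0) #0)
    (varᶜ (# 3))))

-- Turing reducibility

Total : 𝟚^ω → (ℕ → ℕ) → Set
Total Z f = ∃[ e ] ∀ x → Φ Z e x (f x)

Computable⇒Total : ∀ {Z} {f : Vec ℕ 1 → ℕ} → Computable Z f → Total Z (λ x → f (x ∷ []))
Computable⇒Total (computable e r) =
  compᵢ e (pairᵢ ⟨ 0 , 0 ⟩ ⟨ 2 , 0 ⟩) , λ x → compᵣ _ _ (pairᵣ _ _ zer iden) (r (x ∷ []))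

Total⇒Computable : ∀ {Z n f} {g : Vec ℕ n → ℕ} → Total Z f → Computable Z g → Computable Z (λ v → f (g v))
Total⇒Computable (e , r) (computable a s) = computable (compᵢ e a) λ v → compᵣ e a (s v) (r _)

χ≡1 : ∀ X n → χ X n ≡ 1 ⇔ X n ≡ true
χ≡1 X n with X n
... | true  = mk⇔ (λ _ → refl) (λ _ → refl)
... | false = mk⇔ (λ ()) (λ ())

∈ᵈ : ∀ {X Z n} {f : Vec ℕ n → ℕ} → X ≤ᵀ Z → Computable Z f → Decidable Z (λ v → X (f v) ≡ true)
∈ᵈ {X} X≤Z c = mapᵈ (λ v → χ≡1 X _) (Total⇒Computable X≤Z c ≡ᵈ constᶜ 1)

Decidable⇒≤ᵀ : ∀ {X Z} → Decidable Z {1} (λ v → X (head v) ≡ true) → X ≤ᵀ Z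
Decidable⇒≤ᵀ {X} d = Computable⇒Total (χᶜ (λ _ → X) d)

≤ᵀ-refl : ∀ {X} → X ≤ᵀ X
≤ᵀ-refl = ⟨ 5 , 0 ⟩ , λ n → query

-- A single search over codes `⟨ σ , s ⟩` of a parameter and a fuel: completeness of the evaluator
-- makes it total, soundness makes its result a value of `Φ`. A constant family gives transitivity
-- of reducibility; the family of grafts gives the function that forcing compares with the diagonal.
uniformize : ∀ {Z} {O : Family 1} → DecidableFamily Z O → ∀ e →
  (∀ x → ∃[ σ ] ∃[ y ] Φ (O (σ ∷ [])) e x y) →
  ∃[ g ] Total Z g × (∀ x → ∃[ σ ] Φ (O (σ ∷ [])) e x (g x))
uniformize {Z} {O} Oᵈ e h =
    (λ x → pred (value (p (x ∷ [])) x))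
  , Computable⇒Total (predᶜ (evᶜ {O = O} Oᵈ code ∘ᶜ (#0 ∷ᶜ π₂ᶜ pᶜ ∷ᶜ π₁ᶜ pᶜ ∷ᶜ []ᶜ)))
  , λ x → π₁ (p (x ∷ [])) , ev-sound (suc e) e (nonzero (hit (x ∷ [])))
  where
  code : Code
  code = decode (suc e) e
  value : ℕ → ℕ → ℕ
  value p x = ev code (O (π₁ p ∷ [])) (π₂ p) x
  convergent : Decidable Z {2} (λ v → value (lookup v (# 0)) (lookup v (# 1)) ≢ 0)
  convergent = ¬ᵈ ((evᶜ {O = O} Oᵈ code ∘ᶜ (#1 ∷ᶜ π₂ᶜ #0 ∷ᶜ π₁ᶜ #0 ∷ᶜ []ᶜ)) ≡ᵈ constᶜ 0)
  exists : ∀ v → ∃[ p ] value p (lookup v (# 0)) ≢ 0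
  exists (x ∷ []) =
    let σ , y , φ = h x
        s , good  = ev-complete φ (suc e) ≤-refl
    in ⟨ σ , s ⟩ , λ undefined → 0≢1+n (trans (sym undefined)
         (trans (cong₂ (λ σ s → ev code (O (σ ∷ [])) s x) (π₁-⟨⟩ σ s) (π₂-⟨⟩ σ s)) (good s ≤-refl)))
  found : ∃[ f ] Computable Z f × (∀ v → value (f v) (lookup v (# 0)) ≢ 0)
  found = search convergent exists
  p : Vec ℕ 1 → ℕ
  p = proj₁ found
  pᶜ : Computable Z p
  pᶜ = proj₁ (proj₂ found)
  hit : ∀ v → value (p v) (lookup v (# 0)) ≢ 0
  hit = proj₂ (proj₂ found)
  nonzero : ∀ {m} → m ≢ 0 → m ≡ suc (pred m)
  nonzero {zero}  q = ⊥-elim (q refl)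
  nonzero {suc m} q = refl

Total-trans : ∀ {X Y f} → Total X f → X ≤ᵀ Y → Total Y f
Total-trans {X} {Y} {f} (e , r) X≤Y =
  let g , (e′ , s) , h = uniformize {O = λ _ → X} (∈ᵈ X≤Y headᶜ) e (λ x → 0 , f x , r x)
  in e′ , λ x → subst (Φ Y e′ x) (Φ-functional (proj₂ (h x)) (r x)) (s x)

≤ᵀ-trans : ∀ {X Y W} → X ≤ᵀ Y → Y ≤ᵀ W → X ≤ᵀ W
≤ᵀ-trans = Total-trans

-- The use principle

Agree : ℕ → 𝟚^ω → 𝟚^ω → Set
Agree u X Y = ∀ n → n < u → X n ≡ Y n

Continuous : 𝟚^ω → (𝟚^ω → Set) → Set
Continuous X P = ∃[ u ] ∀ Y → Agree u X Y → P Y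

continuous-map₂ : ∀ {X} {P Q R : 𝟚^ω → Set} → (∀ {Y} → P Y → Q Y → R Y) →
                  Continuous X P → Continuous X Q → Continuous X R
continuous-map₂ f (u , p) (v , q) = u ⊔ v , λ Y agree → f
  (p Y λ n n<u → agree n (<-≤-trans n<u (m≤m⊔n u v)))
  (q Y λ n n<v → agree n (<-≤-trans n<v (m≤n⊔m u v)))

use : ∀ {X e x y} → Φ X e x y → Continuous X (λ Y → Φ Y e x y)
use zer   = 0 , λ Y _ → zer
use succ  = 0 , λ Y _ → succ
use iden  = 0 , λ Y _ → iden
use (left {x} {y})  = 0 , λ Y _ → left {x = x} {y}
use (right {x} {y}) = 0 , λ Y _ → right {x = x} {y}
use {X} (query {x}) = suc x , λ Y agree →
  subst (Φ Y ⟨ 5 , 0 ⟩ x) (cong (if_then 1 else 0) (sym (agree x ≤-refl))) query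
use (pair {a} {b} φ ψ) = continuous-map₂ (pair {a = a} {b}) (use φ) (use ψ)
use (comp {a} {b} φ ψ) = continuous-map₂ (comp {a = a} {b}) (use φ) (use ψ)
use (rec₀ {a} {b} {x} φ) = let u , p = use φ in u , λ Y agree → rec₀ {a = a} {b} {x} (p Y agree)
use (rec₊ {a} {b} {x} {n} {y} φ ψ) = continuous-map₂ (rec₊ {a = a} {b} {x} {n} {y}) (use φ) (use ψ)
use (stop {a} {x} {n} φ) = let u , p = use φ in u , λ Y agree → stop {a = a} {x} {n} (p Y agree)
use (next {a} {x} {n} {y} φ ψ) = continuous-map₂ (next {a = a} {x} {n} {y}) (use φ) (use ψ)

-- Halving and the join

half-unique : ∀ {n q} → q * 2 ≤ n → n < suc q * 2 → q ≡ n / 2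
half-unique {n} {q} lo up with <-cmp q (n / 2)
... | tri≈ _ p _ = p
... | tri< q< _ _ = ⊥-elim (<⇒≱ up (≤-trans (*-monoˡ-≤ 2 q<)
        (≤-trans (m≤n+m (n / 2 * 2) (n % 2)) (≤-reflexive (sym (m≡m%n+[m/n]*n n 2))))))
... | tri> _ _ q> = ⊥-elim (<⇒≱ (≤-<-trans (≤-reflexive (m≡m%n+[m/n]*n n 2))
        (+-monoˡ-< (n / 2 * 2) (m%n<n n 2))) (≤-trans (*-monoˡ-≤ 2 q>) lo))

module _ {Z : 𝟚^ω} where

  halfᶜ : ∀ {n} {f : Vec ℕ n → ℕ} → Computable Z f → Computable Z (λ v → f v / 2)
  halfᶜ {f = f} c = from-graph (λ v → f v / 2)
    (mapᵈ (λ { (q ∷ v) → mk⇔ (λ (lo , up) → half-unique lo up) (λ { refl → lower (f v) , upper (f v) }) })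
      ((#0 *ᶜ constᶜ 2 ≤ᵈ c ∘ᶜ tailᶜ) ×ᵈ (c ∘ᶜ tailᶜ <ᵈ sucᶜ #0 *ᶜ constᶜ 2)))
    where
    lower : ∀ m → m / 2 * 2 ≤ m
    lower m = ≤-trans (m≤n+m (m / 2 * 2) (m % 2)) (≤-reflexive (sym (m≡m%n+[m/n]*n m 2)))
    upper : ∀ m → m < suc (m / 2) * 2
    upper m = ≤-<-trans (≤-reflexive (m≡m%n+[m/n]*n m 2)) (+-monoˡ-< (m / 2 * 2) (m%n<n m 2))

  parityᶜ : ∀ {n} {f : Vec ℕ n → ℕ} → Computable Z f → Computable Z (λ v → f v % 2)
  parityᶜ {f = f} c = cong-comp (λ v → sym (m%n≡m∸m/n*n (f v) 2)) (c ∸ᶜ halfᶜ c *ᶜ constᶜ 2)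

  ⊕ᵈ : ∀ {k} {X Y : Family k} → DecidableFamily Z X → DecidableFamily Z Y →
       DecidableFamily Z (λ v → X v ⊕ Y v)
  ⊕ᵈ {k} {X} {Y} Xᵈ Yᵈ = mapᵈ (λ { (n ∷ v) → lemma n v })
    (((parityᶜ #0 ≡ᵈ constᶜ 0) ×ᵈ Xᵈ ∘ᵈ (halfᶜ #0 ∷ᶜ tailᶜ)) ⊎ᵈ
     (¬ᵈ (parityᶜ #0 ≡ᵈ constᶜ 0) ×ᵈ Yᵈ ∘ᵈ (halfᶜ #0 ∷ᶜ tailᶜ)))
    where
    lemma : ∀ n v → (n % 2 ≡ 0 × X v (n / 2) ≡ true ⊎ n % 2 ≢ 0 × Y v (n / 2) ≡ true) ⇔ ((X v ⊕ Y v) n ≡ true)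
    lemma n v with n % 2
    ... | zero  = mk⇔ (λ { (inj₁ (_ , p)) → p ; (inj₂ (q , _)) → ⊥-elim (q refl) }) (λ p → inj₁ (refl , p))
    ... | suc _ = mk⇔ (λ { (inj₁ (() , _)) ; (inj₂ (_ , p)) → p }) (λ p → inj₂ ((λ ()) , p))

⊕-least : ∀ {X Y Z} → X ≤ᵀ Z → Y ≤ᵀ Z → X ⊕ Y ≤ᵀ Z
⊕-least {X} {Y} X≤Z Y≤Z = Decidable⇒≤ᵀ (⊕ᵈ {X = λ _ → X} {λ _ → Y} (∈ᵈ X≤Z headᶜ) (∈ᵈ Y≤Z headᶜ))

≤ᵀ-⊕ˡ : ∀ X Y → X ≤ᵀ X ⊕ Y
≤ᵀ-⊕ˡ X Y = Decidable⇒≤ᵀ (mapᵈ (λ { (n ∷ []) → lemma n }) (∈ᵈ ≤ᵀ-refl (#0 *ᶜ constᶜ 2)))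
  where
  parity : ∀ n → n * 2 % 2 ≡ 0
  parity n = m*n%n≡0 n 2
  half : ∀ n → n * 2 / 2 ≡ n
  half n = m*n/n≡m n 2
  lemma : ∀ n → (X ⊕ Y) (n * 2) ≡ true ⇔ X n ≡ true
  lemma n rewrite parity n | half n = mk⇔ (λ p → p) (λ p → p)

≤ᵀ-⊕ʳ : ∀ X Y → Y ≤ᵀ X ⊕ Y
≤ᵀ-⊕ʳ X Y = Decidable⇒≤ᵀ (mapᵈ (λ { (n ∷ []) → lemma n }) (∈ᵈ ≤ᵀ-refl (sucᶜ (#0 *ᶜ constᶜ 2))))
  where
  parity : ∀ n → suc (n * 2) % 2 ≡ 1
  parity n = [m+kn]%n≡m%n 1 n 2
  half : ∀ n → suc (n * 2) / 2 ≡ n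
  half n = sym (half-unique (n≤1+n (n * 2)) ≤-refl)
  lemma : ∀ n → (X ⊕ Y) (suc (n * 2)) ≡ true ⇔ Y n ≡ true
  lemma n rewrite parity n | half n = mk⇔ (λ p → p) (λ p → p)

-- Mathias forcing

positive : ℕ → Bool
positive zero    = false
positive (suc _) = true

tails : ℕ → ℕ → ℕ
tails σ n = natrec σ (λ _ r → π₂ r) n

-- Only initial segments of bit σ matter: beyond the coded sequence it is junk.
bit : ℕ → 𝟚^ω
bit σ n = positive (π₁ (tails σ n))

prefix : 𝟚^ω → ℕ → ℕ
prefix X zero    = 0
prefix X (suc u) = ⟨ χ X 0 , prefix (X ∘ suc) u ⟩

bit-prefix : ∀ X u n → n < u → bit (prefix X u) n ≡ X n
bit-prefix X (suc u) zero _ = trans (cong positive (π₁-⟨⟩ (χ X 0) (prefix (X ∘ suc) u))) (lemma (X 0))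
  where
  lemma : ∀ b → positive (if b then 1 else 0) ≡ b
  lemma true  = refl
  lemma false = refl
bit-prefix X (suc u) (suc n) (s≤s n<u) =
  trans (cong (positive ∘ π₁) (shift-tails ⟨ χ X 0 , prefix (X ∘ suc) u ⟩ n))
    (trans (cong (λ σ → bit σ n) (π₂-⟨⟩ (χ X 0) (prefix (X ∘ suc) u))) (bit-prefix (X ∘ suc) u n n<u))
  where
  shift-tails : ∀ σ n → tails σ (suc n) ≡ tails (π₂ σ) n
  shift-tails σ zero    = refl
  shift-tails σ (suc n) = cong π₂ (shift-tails σ n)

bitᵈ : ∀ {Z n} {f g : Vec ℕ n → ℕ} → Computable Z f → Computable Z g → Decidable Z (λ v → bit (f v) (g v) ≡ true)
bitᵈ {f = f} {g} c d = mapᵈ (λ v → lemma (π₁ (tails (f v) (g v)))) (¬ᵈ (π₁ᶜ (natrecᶜ c (π₂ᶜ #0) d) ≡ᵈ constᶜ 0))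
  where
  lemma : ∀ m → m ≢ 0 ⇔ positive m ≡ true
  lemma zero    = mk⇔ (λ p → ⊥-elim (p refl)) (λ ())
  lemma (suc m) = mk⇔ (λ _ → refl) (λ _ ())

∅ : 𝟚^ω
∅ _ = false

NoDNR : 𝟚^ω → Set
NoDNR Z = ∀ f → Total Z f → ¬ DNRFor ∅ f

∅-NoDNR : NoDNR ∅
∅-NoDNR f (e , r) dnr = dnr e (f e) (r e) refl

∧-true : ∀ {a b} → a ∧ b ≡ true ⇔ (a ≡ true × b ≡ true)
∧-true {true}  = mk⇔ (λ p → refl , p) proj₂
∧-true {false} = mk⇔ (λ ()) (λ ())

not-true : ∀ {b} → not b ≡ true ⇔ (¬ b ≡ true)
not-true {true}  = mk⇔ (λ ()) (λ p → ⊥-elim (p refl))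
not-true {false} = mk⇔ (λ _ ()) (λ _ → refl)

∩-≤ᵀ : ∀ {X Y Z} → X ≤ᵀ Z → Y ≤ᵀ Z → X ∩ Y ≤ᵀ Z
∩-≤ᵀ X≤Z Y≤Z = Decidable⇒≤ᵀ (mapᵈ (λ { (n ∷ []) → mk⇔ (from ∧-true) (to ∧-true) }) (∈ᵈ X≤Z #0 ×ᵈ ∈ᵈ Y≤Z #0))

∁-≤ᵀ : ∀ {X Z} → X ≤ᵀ Z → ∁ X ≤ᵀ Z
∁-≤ᵀ X≤Z = Decidable⇒≤ᵀ (mapᵈ (λ { (n ∷ []) → mk⇔ (from not-true) (to not-true) }) (¬ᵈ (∈ᵈ X≤Z #0)))

-- A Mathias condition: the stem is the part of bit stem below bound.
record Condition (Z : 𝟚^ω) : Set where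
  field
    stem bound : ℕ
    reservoir  : 𝟚^ω
    reservoir≤ : reservoir ≤ᵀ Z
    infinite   : Infinite reservoir

open Condition

record Meets {Z} (G : 𝟚^ω) (c : Condition Z) : Set where
  constructor meets
  field
    below : ∀ n → n < bound c → G n ≡ bit (stem c) n
    above : ∀ n → bound c ≤ n → G n ≡ true → reservoir c n ≡ true

open Meets

module _ {Z : 𝟚^ω} where

  infix 4 _⊑_
  -- Extension is read off the sets meeting the conditions, so forced properties pass to extensions
  -- by composition.
  _⊑_ : Condition Z → Condition Z → Set
  d ⊑ c = bound c ≤ bound d × ∀ G → Meets G d → Meets G c

  ⊑-refl : ∀ {c} → c ⊑ c
  ⊑-refl = ≤-refl , λ G m → m

  ⊑-trans : ∀ {c d e} → e ⊑ d → d ⊑ c → e ⊑ c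
  ⊑-trans (b , f) (b′ , f′) = ≤-trans b′ b , λ G m → f′ G (f G m)

  Forces : Condition Z → (𝟚^ω → Set) → Set
  Forces c P = ∀ G → Meets G c → P G

  -- A retraction of all sets onto those meeting `c`. Hence `σ` may range over every number: each
  -- `graft c (bit σ)` is admissible, and every initial segment of a set meeting `c` arises in this
  -- way.
  graft : Condition Z → 𝟚^ω → 𝟚^ω
  graft c H n with n <? bound c
  ... | yes _ = bit (stem c) n
  ... | no  _ = H n ∧ reservoir c n

  graft-below : ∀ c H n → n < bound c → graft c H n ≡ bit (stem c) n
  graft-below c H n p with n <? bound c
  ... | yes _ = refl
  ... | no ¬p = ⊥-elim (¬p p)

  graft-above : ∀ c H n → bound c ≤ n → graft c H n ≡ H n ∧ reservoir c n
  graft-above c H n p with n <? bound c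
  ... | yes q = ⊥-elim (<⇒≱ q p)
  ... | no  _ = refl

  graft-meets : ∀ c H → Meets (graft c H) c
  graft-meets c H = meets (graft-below c H)
    (λ n p q → proj₂ (to ∧-true (trans (sym (graft-above c H n p)) q)))

  graft-agrees : ∀ c G H → Meets G c → ∀ n → H n ≡ G n → graft c H n ≡ G n
  graft-agrees c G H m n H≡G with n <? bound c
  ... | yes p = sym (below m n p)
  ... | no ¬p with H n | G n in eqn | H≡G
  ...   | true  | true  | refl = above m n (≮⇒≥ ¬p) eqn
  ...   | false | false | refl = refl

  extend : Condition Z → 𝟚^ω → ℕ → Condition Z
  extend c H u = record
    { stem = prefix H u ; bound = u ; reservoir = reservoir c
    ; reservoir≤ = reservoir≤ c ; infinite = infinite c }

  extend-agrees : ∀ c H u → Forces (extend c H u) (Agree u H)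
  extend-agrees c H u G m n n<u = sym (trans (below m n n<u) (bit-prefix H u n n<u))

  extend-⊑ : ∀ c H u → Meets H c → bound c ≤ u → extend c H u ⊑ c
  extend-⊑ c H u mH b≤u = b≤u , λ G m → meets
    (λ n n<b → trans (sym (extend-agrees c H u G m n (<-≤-trans n<b b≤u))) (below mH n n<b))
    (λ n b≤n g → case G m n b≤n g (n <? u))
    where
    case : ∀ G → Meets G (extend c H u) → ∀ n → bound c ≤ n → G n ≡ true → Dec (n < u) → reservoir c n ≡ true
    case G m n b≤n g (yes n<u) = above mH n b≤n (trans (extend-agrees c H u G m n n<u) g)
    case G m n b≤n g (no n≮u)  = above m n (≮⇒≥ n≮u) g

  -- Here computability of the reservoir from `Z` enters: it makes the grafts uniformly decidable in
  -- `σ`, so that one `Z`-computation can search through them.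
  graftᵈ : ∀ c → DecidableFamily Z {1} (λ v → graft c (bit (head v)))
  graftᵈ c = mapᵈ (λ { (n ∷ σ ∷ []) → lemma n σ })
    (((#0 <ᵈ constᶜ (bound c)) ×ᵈ bitᵈ (constᶜ (stem c)) #0)
     ⊎ᵈ ((constᶜ (bound c) ≤ᵈ #0) ×ᵈ bitᵈ #1 #0 ×ᵈ ∈ᵈ (reservoir≤ c) #0))
    where
    lemma : ∀ n σ → (n < bound c × bit (stem c) n ≡ true
                     ⊎ bound c ≤ n × bit σ n ≡ true × reservoir c n ≡ true) ⇔ graft c (bit σ) n ≡ true
    lemma n σ with n <? bound c
    ... | yes p = mk⇔ (λ { (inj₁ (_ , q)) → q ; (inj₂ (q , _)) → ⊥-elim (<⇒≱ p q) }) (λ q → inj₁ (p , q))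
    ... | no ¬p = mk⇔ (λ { (inj₁ (p , _)) → ⊥-elim (¬p p) ; (inj₂ (_ , q)) → from ∧-true q })
                      (λ q → inj₂ (≮⇒≥ ¬p , to ∧-true q))

  ⊕-agree : ∀ {X Y} u → Agree u X Y → Agree u (Z ⊕ X) (Z ⊕ Y)
  ⊕-agree u agree n n<u = cong (if n % 2 ≡ᵇ 0 then Z (n / 2) else_) (agree (n / 2) (≤-<-trans (m/n≤m n 2) n<u))

-- The generic set over a good oracle

module Forcing (em : ExcludedMiddle 0ℓ) (Z : 𝟚^ω) (noDNR : NoDNR Z) where

  Avoids : ℕ → 𝟚^ω → Set
  Avoids e G = ∀ f → DNRFor ∅ f → ¬ (∀ x → Φ (Z ⊕ G) e x (f x))

  select : ∀ e c → (∀ x → ∃[ σ ] ∃[ y ] Φ (Z ⊕ graft c (bit σ)) e x y) →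
           ∃[ g ] Total Z g × (∀ x → ∃[ σ ] Φ (Z ⊕ graft c (bit σ)) e x (g x))
  select e c = uniformize {O = λ v → Z ⊕ graft c (bit (head v))}
    (⊕ᵈ {X = λ _ → Z} {λ v → graft c (bit (head v))} (∈ᵈ ≤ᵀ-refl headᶜ) (graftᵈ c)) e

  coincidence : ∀ g → Total Z g → ∃[ x ] Φ ∅ x x (g x)
  coincidence g gᵗ with em {∃[ x ] Φ ∅ x x (g x)}
  ... | yes p = p
  ... | no ¬p = ⊥-elim (noDNR g gᵗ λ x y φ eqn → ¬p (x , subst (Φ ∅ x x) (sym eqn) φ))

  avoid : ∀ e c → ∃[ d ] d ⊑ c × Forces d (Avoids e)
  avoid e c with em {∃[ x ] ∀ σ y → ¬ Φ (Z ⊕ graft c (bit σ)) e x y}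
  ... | yes (x , diverges) = c , ⊑-refl , λ G m f dnr r →
    -- A computation converging on `Z ⊕ G` reads only a prefix of `G`, and the graft of that prefix
    -- would converge as well.
    let u , φ = use (r x)
        σ = prefix G u
    in diverges σ (f x) (φ (Z ⊕ graft c (bit σ)) (⊕-agree {Z} u λ n n<u →
         sym (graft-agrees c G (bit σ) m n (bit-prefix G u n n<u))))
  ... | no converges =
    let g , gᵗ , value = select e c total
        x , φ = coincidence g gᵗ
        σ , ψ = value x
        u , ψ′ = use ψ
        H = graft c (bit σ)
        -- Long enough to preserve the computation `ψ` and not to shorten the stem.
        v = u ⊔ bound c
    in extend c H v , extend-⊑ c H v (graft-meets c (bit σ)) (m≤n⊔m u (bound c)) ,
       λ G m f dnr r → dnr x (g x) φ
         (Φ-functional (r x) (ψ′ (Z ⊕ G) (⊕-agree {Z} u λ n n<u →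
           extend-agrees c H v G m n (<-≤-trans n<u (m≤m⊔n u (bound c))))))
    where
    total : ∀ x → ∃[ σ ] ∃[ y ] Φ (Z ⊕ graft c (bit σ)) e x y
    total x with em {∃[ σ ] ∃[ y ] Φ (Z ⊕ graft c (bit σ)) e x y}
    ... | yes p = p
    ... | no ¬p = ⊥-elim (converges (x , λ σ y φ → ¬p (σ , y , φ)))

  Decides : ℕ → 𝟚^ω → Set
  Decides e G = ∀ R → (∀ n → Φ Z e n (χ R n)) → Finite (G ∩ R) ⊎ Finite (G ∩ ∁ R)

  thin : ∀ (c : Condition Z) R → R ≤ᵀ Z → Infinite (reservoir c ∩ R) → Condition Z
  thin c R R≤Z inf = record c { reservoir = reservoir c ∩ R ; reservoir≤ = ∩-≤ᵀ (reservoir≤ c) R≤Z ; infinite = inf }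

  thin-⊑ : ∀ c R R≤Z inf → thin c R R≤Z inf ⊑ c
  thin-⊑ c R R≤Z inf = ≤-refl , λ G m → meets (below m) λ n b≤n g → proj₁ (to ∧-true (above m n b≤n g))

  thin-finite : ∀ c R R≤Z inf S → (∀ n → R n ≡ true → ¬ S n ≡ true) → Forces (thin c R R≤Z inf) (λ G → Finite (G ∩ S))
  thin-finite c R R≤Z inf S disjoint G m = bound c , λ n p →
    let g , s = to ∧-true p in
    ≰⇒> λ b≤n → disjoint n (proj₂ (to (∧-true {reservoir c n}) (above m n b≤n g))) s

  split : ∀ X R → Infinite X → Infinite (X ∩ R) ⊎ Infinite (X ∩ ∁ R)
  split X R inf with em {∃[ b ] ∀ n → b < n → X n ≡ true → R n ≡ false}
  ... | yes (b , none) = inj₂ λ b′ →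
    let n , lt′ , x = inf (b ⊔ b′)
        b<n = ≤-<-trans (m≤m⊔n b b′) lt′
    in n , ≤-<-trans (m≤n⊔m b b′) lt′ , from ∧-true (x , cong not (none n b<n x))
  ... | no ¬none = inj₁ hit
    where
    hit : Infinite (X ∩ R)
    hit b with em {∃[ n ] b < n × (X ∩ R) n ≡ true}
    ... | yes p = p
    ... | no ¬p = ⊥-elim (¬none (b , λ n b<n x → ¬-not λ r → ¬p (n , b<n , from ∧-true (x , r))))

  -- By functionality of `Φ` an index computes at most one set from `Z`, so thinning the reservoir
  -- once settles the requirement.
  decide-set : ∀ e c → ∃[ d ] d ⊑ c × Forces d (Decides e)
  decide-set e c with em {∃[ R ] ∀ n → Φ Z e n (χ R n)}
  ... | no ¬p = c , ⊑-refl , λ G m R r → ⊥-elim (¬p (R , r))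
  ... | yes (R , r) with split (reservoir c) R (infinite c)
  ...   | inj₁ inf = thin c R (e , r) inf , thin-⊑ c R (e , r) inf , λ G m R′ r′ →
    inj₂ (thin-finite c R (e , r) inf (∁ R′) (λ n p q → to not-true q (trans (same R′ r′ n) p)) G m)
    where
    same : ∀ R′ → (∀ n → Φ Z e n (χ R′ n)) → ∀ n → R′ n ≡ R n
    same R′ r′ n with R′ n | R n | Φ-functional (r′ n) (r n)
    ... | true  | true  | _ = refl
    ... | false | false | _ = refl
  ...   | inj₂ inf = thin c (∁ R) (∁-≤ᵀ (e , r)) inf , thin-⊑ c (∁ R) (∁-≤ᵀ (e , r)) inf , λ G m R′ r′ →
    inj₁ (thin-finite c (∁ R) (∁-≤ᵀ (e , r)) inf R′ (λ n p q → to not-true p (trans (same R′ r′ n) q)) G m)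
    where
    same : ∀ R′ → (∀ n → Φ Z e n (χ R′ n)) → ∀ n → R n ≡ R′ n
    same R′ r′ n with R′ n | R n | Φ-functional (r′ n) (r n)
    ... | true  | true  | _ = refl
    ... | false | false | _ = refl

  -- The larger bound makes the stems converge to a set, and the new element makes that set
  -- infinite.
  grow : ∀ (c : Condition Z) → ∃[ d ] d ⊑ c × bound c < bound d × Forces d (λ G → ∃[ n ] bound c < n × G n ≡ true)
  grow c = let n , b<n , p = infinite c (bound c)
               H = graft c (reservoir c)
           in extend c H (suc n)
            , extend-⊑ c H (suc n) (graft-meets c (reservoir c)) (m≤n⇒m≤1+n (<⇒≤ b<n))
            , m<n⇒m<1+n b<n
            , λ G m → n , b<n , trans (sym (extend-agrees c H (suc n) G m n ≤-refl))
                (trans (graft-above c (reservoir c) n (<⇒≤ b<n)) (from ∧-true (p , p)))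

  Step : ℕ → Condition Z → Condition Z → Set
  Step e c d = d ⊑ c × bound c < bound d ×
    Forces d (λ G → Avoids e G × Decides e G × ∃[ n ] e < n × G n ≡ true)

  abstract
    -- The hypothesis turns an element beyond the bound into one beyond `e`.
    step : ∀ e c → e ≤ bound c → ∃[ d ] Step e c d
    step e c e≤b =
      let d₁ , le₁ , avoids  = avoid e c
          d₂ , le₂ , decides = decide-set e d₁
          d₃ , le₃ , b<b , grows = grow d₂
          le₂₃ = ⊑-trans {d = d₂} le₃ le₂
          b≤b = ≤-trans (proj₁ le₁) (proj₁ le₂)
      in d₃ , ⊑-trans {d = d₁} le₂₃ le₁ , ≤-<-trans b≤b b<b ,
         λ G m → avoids G (proj₂ le₂₃ G m) , decides G (proj₂ le₃ G m) ,
           let n , b<n , g = grows G m in n , ≤-<-trans (≤-trans e≤b b≤b) b<n , g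

  conditions : ∀ k → Σ[ c ∈ Condition Z ] k ≤ bound c
  conditions zero = record
    { stem = 0 ; bound = 0 ; reservoir = λ _ → true ; infinite = λ b → suc b , ≤-refl , refl
    ; reservoir≤ = Decidable⇒≤ᵀ (mapᵈ (λ v → mk⇔ (λ _ → refl) (λ _ → refl)) (constᶜ 0 ≡ᵈ constᶜ 0)) } , z≤n
  conditions (suc k) =
    let c , k≤b = conditions k
        d , _ , b<b , _ = step k c k≤b
    in d , ≤-trans (s≤s k≤b) b<b

  at : ℕ → Condition Z
  at k = proj₁ (conditions k)

  at-step : ∀ k → Step k (at k) (at (suc k))
  at-step k = proj₂ (step k (at k) (proj₂ (conditions k)))

  at-⊑ : ∀ {k j} → k ≤ j → at j ⊑ at k
  at-⊑ {k} {j} k≤j with m≤n⇒m<n∨m≡n k≤j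
  at-⊑ k≤j | inj₂ refl = ⊑-refl
  at-⊑ {k} {suc j} k≤j | inj₁ (s≤s k≤j′) = ⊑-trans {d = at j} (proj₁ (at-step j)) (at-⊑ k≤j′)

  -- Stage `suc n` has bound at least `suc n`, so bit `n` already belongs to its stem and is kept by
  -- all later stages.
  generic : 𝟚^ω
  generic n = bit (stem (at (suc n))) n

  generic-stem : ∀ k n → n < bound (at k) → generic n ≡ bit (stem (at k)) n
  generic-stem k n n<b = [ older , newer ]′ (≤-total k (suc n))
    where
    n<b′ : n < bound (at (suc n))
    n<b′ = proj₂ (conditions (suc n))
    -- Grafting `∅` onto the later condition gives one set that meets both stages, through which
    -- their stems are compared.
    stem-meets : ∀ {i j} → i ≤ j → Meets (graft (at j) ∅) (at i)
    stem-meets {j = j} i≤j = proj₂ (at-⊑ i≤j) (graft (at j) ∅) (graft-meets (at j) ∅)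
    older : k ≤ suc n → generic n ≡ bit (stem (at k)) n
    older k≤n = trans (sym (graft-below (at (suc n)) ∅ n n<b′)) (below (stem-meets k≤n) n n<b)
    newer : suc n ≤ k → generic n ≡ bit (stem (at k)) n
    newer n<k = trans (sym (below (stem-meets n<k) n n<b′)) (graft-below (at k) ∅ n n<b)

  generic-meets : ∀ k → Meets generic (at k)
  generic-meets k = meets (generic-stem k) λ n b≤n g →
    let k≤n = m≤n⇒m≤1+n (≤-trans (proj₂ (conditions k)) b≤n) in
    above (proj₂ (at-⊑ k≤n) (graft (at (suc n)) ∅) (graft-meets (at (suc n)) ∅)) n b≤n
      (trans (graft-below (at (suc n)) ∅ n (proj₂ (conditions (suc n)))) g)

  generic-forced : ∀ e → Avoids e generic × Decides e generic × ∃[ n ] e < n × generic n ≡ true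
  generic-forced e = proj₂ (proj₂ (at-step e)) generic (generic-meets (suc e))

  generic-NoDNR : NoDNR (Z ⊕ generic)
  generic-NoDNR f (e , r) dnr = proj₁ (generic-forced e) f dnr r

  generic-infinite : Infinite generic
  generic-infinite b = proj₂ (proj₂ (generic-forced b))

  generic-cohesive : ∀ R → R ≤ᵀ Z → Finite (generic ∩ R) ⊎ Finite (generic ∩ ∁ R)
  generic-cohesive R (e , r) = proj₁ (proj₂ (generic-forced e)) R r

-- The ideal generated by the tower

module Ideal (em : ExcludedMiddle 0ℓ) where

  tower : ℕ → Σ[ Z ∈ 𝟚^ω ] NoDNR Z
  tower zero    = ∅ , ∅-NoDNR
  tower (suc n) = let Z , noDNR = tower n in
    Z ⊕ Forcing.generic em Z noDNR , Forcing.generic-NoDNR em Z noDNR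

  Z : ℕ → 𝟚^ω
  Z n = proj₁ (tower n)

  Z-mono : ∀ {m n} → m ≤ n → Z m ≤ᵀ Z n
  Z-mono {m} {n} m≤n with m≤n⇒m<n∨m≡n m≤n
  Z-mono m≤n | inj₂ refl = ≤ᵀ-refl
  Z-mono {m} {suc n} _ | inj₁ (s≤s m≤n) = ≤ᵀ-trans (Z-mono m≤n) (≤ᵀ-⊕ˡ (Z n) (Forcing.generic em (Z n) (proj₂ (tower n))))

  M : 𝟚^ω → Set
  M X = ∃[ n ] X ≤ᵀ Z n

  M-ideal : TuringIdeal M
  M-ideal = record
    { nonempty  = ∅ , 0 , ≤ᵀ-refl
    ; ≤ᵀ-closed = λ { X≤Y (n , Y≤Z) → n , ≤ᵀ-trans X≤Y Y≤Z }
    ; ⊕-closed  = λ { (m , X≤Z) (n , Y≤Z) → m ⊔ n ,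
        ⊕-least (≤ᵀ-trans X≤Z (Z-mono (m≤m⊔n m n))) (≤ᵀ-trans Y≤Z (Z-mono (m≤n⊔m m n))) } }

  row-≤ᵀ : ∀ {R Y} i → R ≤ᵀ Y → R ⟦ i ⟧ ≤ᵀ Y
  row-≤ᵀ {R} i R≤Y = Decidable⇒≤ᵀ (mapᵈ (λ { (n ∷ []) → mk⇔ (λ p → p) (λ p → p) }) (∈ᵈ R≤Y ⟨ constᶜ i , #0 ⟩ᶜ))

  M-COH : ModelsCOH M
  M-COH R (n , R≤Z) = generic , (suc n , ≤ᵀ-⊕ʳ (Z n) generic) , generic-infinite ,
    λ i → generic-cohesive (R ⟦ i ⟧) (row-≤ᵀ i R≤Z)
    where open Forcing em (Z n) (proj₂ (tower n))

  -- The failure occurs at `∅`: a set in `M` coding the graph of `f` makes `f` computable from some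
  -- good `Z n`, by a search for its value.
  M-¬DNR : ¬ ModelsDNR M
  M-¬DNR dnr =
    let f , (F , (n , F≤Z) , graph) , f-dnr = dnr ∅ (0 , ≤ᵀ-refl)
        fᶜ = from-graph {Z n} {1} (λ v → f (head v))
               (mapᵈ (λ { (y ∷ x ∷ []) → mk⇔ (λ p → sym (to (graph x y) p)) (λ p → from (graph x y) (sym p)) })
                 (∈ᵈ F≤Z ⟨ #1 , #0 ⟩ᶜ))
    in proj₂ (tower n) f (Computable⇒Total fᶜ) f-dnr

-- ω-models of RCA₀

⟦_⟧ᵗ : ∀ {m} → Term m → Vec ℕ m → ℕ
⟦ var i ⟧ᵗ v = lookup v i
⟦ 0̇ ⟧ᵗ     v = 0
⟦ 1̇ ⟧ᵗ     v = 1
⟦ s +̇ t ⟧ᵗ v = ⟦ s ⟧ᵗ v + ⟦ t ⟧ᵗ v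
⟦ s ·̇ t ⟧ᵗ v = ⟦ s ⟧ᵗ v * ⟦ t ⟧ᵗ v

record Substitutes {m m′} (σ : Fin m → Term m′) (v : Vec ℕ m′) (w : Vec ℕ m) : Set where
  constructor substitutes
  field value : ∀ i → ⟦ σ i ⟧ᵗ v ≡ lookup w i

record Renames {k k′} (ρ : Fin k → Fin k′) (S : Vec 𝟚^ω k′) (T : Vec 𝟚^ω k) : Set where
  constructor renames
  field value : ∀ X → lookup S (ρ X) ≡ lookup T X

⟦subᵗ⟧ : ∀ {m m′} {σ : Fin m → Term m′} {v w} → Substitutes σ v w →
         ∀ t → ⟦ subᵗ σ t ⟧ᵗ v ≡ ⟦ t ⟧ᵗ w
⟦subᵗ⟧ (substitutes h) (var i) = h i
⟦subᵗ⟧ h 0̇       = refl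
⟦subᵗ⟧ h 1̇       = refl
⟦subᵗ⟧ h (s +̇ t) = cong₂ _+_ (⟦subᵗ⟧ h s) (⟦subᵗ⟧ h t)
⟦subᵗ⟧ h (s ·̇ t) = cong₂ _*_ (⟦subᵗ⟧ h s) (⟦subᵗ⟧ h t)

⟦wkᵗ⟧ : ∀ {m} (t : Term m) {n v} → ⟦ wkᵗ t ⟧ᵗ (n ∷ v) ≡ ⟦ t ⟧ᵗ v
⟦wkᵗ⟧ t = ⟦subᵗ⟧ (substitutes λ i → refl) t

⟦ext⟧ : ∀ {m m′} {σ : Fin m → Term m′} {v w} → Substitutes σ v w → ∀ n → Substitutes (ext σ) (n ∷ v) (n ∷ w)
⟦ext⟧ {σ = σ} (substitutes h) n = substitutes λ { zero → refl ; (suc i) → trans (⟦wkᵗ⟧ (σ i)) (h i) }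

⟦inst⟧ : ∀ {m} (t : Term m) v → Substitutes (inst t) v (⟦ t ⟧ᵗ v ∷ v)
⟦inst⟧ t v = substitutes λ { zero → refl ; (suc i) → refl }

⟦shift⟧ : ∀ {m} n (v : Vec ℕ m) → Substitutes shift (n ∷ v) (n + 1 ∷ v)
⟦shift⟧ n v = substitutes λ { zero → refl ; (suc i) → refl }

⟦lift⟧ : ∀ {k k′} {ρ : Fin k → Fin k′} {S T} → Renames ρ S T → ∀ Y → Renames (lift 1 ρ) (Y ∷ S) (Y ∷ T)
⟦lift⟧ (renames h) Y = renames λ { zero → refl ; (suc X) → h X }

module Semantics (M : 𝟚^ω → Set) where

  ⟦_⟧ : ∀ {m k} → Form m k → Vec ℕ m → Vec 𝟚^ω k → Set
  ⟦ s ≈̇ t ⟧ v S = ⟦ s ⟧ᵗ v ≡ ⟦ t ⟧ᵗ v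
  ⟦ s <̇ t ⟧ v S = ⟦ s ⟧ᵗ v < ⟦ t ⟧ᵗ v
  ⟦ t ∈̇ X ⟧ v S = lookup S X (⟦ t ⟧ᵗ v) ≡ true
  ⟦ ⊥̇ ⟧     v S = ⊥
  ⟦ φ ∧̇ ψ ⟧ v S = ⟦ φ ⟧ v S × ⟦ ψ ⟧ v S
  ⟦ φ ∨̇ ψ ⟧ v S = ⟦ φ ⟧ v S ⊎ ⟦ ψ ⟧ v S
  ⟦ φ ⇒̇ ψ ⟧ v S = ⟦ φ ⟧ v S → ⟦ ψ ⟧ v S
  ⟦ ∀̇ φ ⟧   v S = ∀ n → ⟦ φ ⟧ (n ∷ v) S
  ⟦ ∃̇ φ ⟧   v S = ∃[ n ] ⟦ φ ⟧ (n ∷ v) S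
  ⟦ ∀̇² φ ⟧  v S = ∀ X → M X → ⟦ φ ⟧ v (X ∷ S)
  ⟦ ∃̇² φ ⟧  v S = ∃[ X ] M X × ⟦ φ ⟧ v (X ∷ S)

  ⟦sub⟧ : ∀ {m m′ k} {σ : Fin m → Term m′} {v w} {S : Vec 𝟚^ω k} →
          Substitutes σ v w → ∀ φ → ⟦ sub σ φ ⟧ v S ⇔ ⟦ φ ⟧ w S
  ⟦sub⟧ h (s ≈̇ t) rewrite ⟦subᵗ⟧ h s | ⟦subᵗ⟧ h t = mk⇔ id id
  ⟦sub⟧ h (s <̇ t) rewrite ⟦subᵗ⟧ h s | ⟦subᵗ⟧ h t = mk⇔ id id
  ⟦sub⟧ h (t ∈̇ X) rewrite ⟦subᵗ⟧ h t = mk⇔ id id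
  ⟦sub⟧ h ⊥̇ = mk⇔ id id
  ⟦sub⟧ h (φ ∧̇ ψ) = mk⇔
    (λ (p , q) → to (⟦sub⟧ h φ) p , to (⟦sub⟧ h ψ) q) (λ (p , q) → from (⟦sub⟧ h φ) p , from (⟦sub⟧ h ψ) q)
  ⟦sub⟧ h (φ ∨̇ ψ) = mk⇔
    (Sum.map (to (⟦sub⟧ h φ)) (to (⟦sub⟧ h ψ))) (Sum.map (from (⟦sub⟧ h φ)) (from (⟦sub⟧ h ψ)))
  ⟦sub⟧ h (φ ⇒̇ ψ) = mk⇔
    (λ f → to (⟦sub⟧ h ψ) ∘ f ∘ from (⟦sub⟧ h φ)) (λ f → from (⟦sub⟧ h ψ) ∘ f ∘ to (⟦sub⟧ h φ))
  ⟦sub⟧ h (∀̇ φ) = mk⇔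
    (λ f n → to (⟦sub⟧ (⟦ext⟧ h n) φ) (f n)) (λ f n → from (⟦sub⟧ (⟦ext⟧ h n) φ) (f n))
  ⟦sub⟧ h (∃̇ φ) = mk⇔
    (λ (n , p) → n , to (⟦sub⟧ (⟦ext⟧ h n) φ) p) (λ (n , p) → n , from (⟦sub⟧ (⟦ext⟧ h n) φ) p)
  ⟦sub⟧ h (∀̇² φ) = mk⇔
    (λ f X m → to (⟦sub⟧ h φ) (f X m)) (λ f X m → from (⟦sub⟧ h φ) (f X m))
  ⟦sub⟧ h (∃̇² φ) = mk⇔
    (λ (X , m , p) → X , m , to (⟦sub⟧ h φ) p) (λ (X , m , p) → X , m , from (⟦sub⟧ h φ) p)

  ⟦ren²⟧ : ∀ {m k k′} {ρ : Fin k → Fin k′} {v : Vec ℕ m} {S T} →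
           Renames ρ S T → ∀ φ → ⟦ ren² ρ φ ⟧ v S ⇔ ⟦ φ ⟧ v T
  ⟦ren²⟧ h (s ≈̇ t) = mk⇔ id id
  ⟦ren²⟧ h (s <̇ t) = mk⇔ id id
  ⟦ren²⟧ (renames h) (t ∈̇ X) rewrite h X = mk⇔ id id
  ⟦ren²⟧ h ⊥̇ = mk⇔ id id
  ⟦ren²⟧ h (φ ∧̇ ψ) = mk⇔
    (λ (p , q) → to (⟦ren²⟧ h φ) p , to (⟦ren²⟧ h ψ) q) (λ (p , q) → from (⟦ren²⟧ h φ) p , from (⟦ren²⟧ h ψ) q)
  ⟦ren²⟧ h (φ ∨̇ ψ) = mk⇔
    (Sum.map (to (⟦ren²⟧ h φ)) (to (⟦ren²⟧ h ψ))) (Sum.map (from (⟦ren²⟧ h φ)) (from (⟦ren²⟧ h ψ)))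
  ⟦ren²⟧ h (φ ⇒̇ ψ) = mk⇔
    (λ f → to (⟦ren²⟧ h ψ) ∘ f ∘ from (⟦ren²⟧ h φ)) (λ f → from (⟦ren²⟧ h ψ) ∘ f ∘ to (⟦ren²⟧ h φ))
  ⟦ren²⟧ h (∀̇ φ) = mk⇔
    (λ f n → to (⟦ren²⟧ h φ) (f n)) (λ f n → from (⟦ren²⟧ h φ) (f n))
  ⟦ren²⟧ h (∃̇ φ) = mk⇔
    (λ (n , p) → n , to (⟦ren²⟧ h φ) p) (λ (n , p) → n , from (⟦ren²⟧ h φ) p)
  ⟦ren²⟧ h (∀̇² φ) = mk⇔
    (λ f X m → to (⟦ren²⟧ (⟦lift⟧ h X) φ) (f X m)) (λ f X m → from (⟦ren²⟧ (⟦lift⟧ h X) φ) (f X m))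
  ⟦ren²⟧ h (∃̇² φ) = mk⇔
    (λ (X , m , p) → X , m , to (⟦ren²⟧ (⟦lift⟧ h X) φ) p)
    (λ (X , m , p) → X , m , from (⟦ren²⟧ (⟦lift⟧ h X) φ) p)

  ⟦wk⟧ : ∀ {m k n} {v : Vec ℕ m} {S : Vec 𝟚^ω k} φ → ⟦ wk φ ⟧ (n ∷ v) S ⇔ ⟦ φ ⟧ v S
  ⟦wk⟧ = ⟦sub⟧ (substitutes λ i → refl)

  ⟦wk²⟧ : ∀ {m k X} {v : Vec ℕ m} {S : Vec 𝟚^ω k} φ → ⟦ wk² φ ⟧ v (X ∷ S) ⇔ ⟦ φ ⟧ v S
  ⟦wk²⟧ = ⟦ren²⟧ (renames λ X → refl)

  ⟦[]⟧ : ∀ {m k} {v : Vec ℕ m} {S : Vec 𝟚^ω k} φ t → ⟦ φ [ t ] ⟧ v S ⇔ ⟦ φ ⟧ (⟦ t ⟧ᵗ v ∷ v) S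
  ⟦[]⟧ {v = v} φ t = ⟦sub⟧ (⟦inst⟧ t v) φ

  ⟦[]²⟧ : ∀ {m k} {v : Vec ℕ m} {S : Vec 𝟚^ω k} φ X → ⟦ φ [ X ]² ⟧ v S ⇔ ⟦ φ ⟧ v (lookup S X ∷ S)
  ⟦[]²⟧ φ X = ⟦ren²⟧ (renames λ { zero → refl ; (suc Y) → refl }) φ

  module _ {Z : 𝟚^ω} where

    termᶜ : ∀ {m} (t : Term m) → Computable Z ⟦ t ⟧ᵗ
    termᶜ (var i) = varᶜ i
    termᶜ 0̇       = constᶜ 0
    termᶜ 1̇       = constᶜ 1
    termᶜ (s +̇ t) = termᶜ s +ᶜ termᶜ t
    termᶜ (s ·̇ t) = termᶜ s *ᶜ termᶜ t

    Δ⁰₀ᵈ : ∀ {m k} {S : Vec 𝟚^ω k} → (∀ X → lookup S X ≤ᵀ Z) →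
           ∀ {φ : Form m k} → Δ⁰₀ φ → Decidable Z (λ v → ⟦ φ ⟧ v S)
    Δ⁰₀ᵈ S≤Z (eq {s} {t})  = termᶜ s ≡ᵈ termᶜ t
    Δ⁰₀ᵈ S≤Z (lt {s} {t})  = termᶜ s <ᵈ termᶜ t
    Δ⁰₀ᵈ S≤Z (mem {t} {X}) = ∈ᵈ (S≤Z X) (termᶜ t)
    Δ⁰₀ᵈ S≤Z bot           = mapᵈ (λ v → mk⇔ (λ ()) (λ ())) (constᶜ 1 ≡ᵈ constᶜ 0)
    Δ⁰₀ᵈ S≤Z (conj p q)    = Δ⁰₀ᵈ S≤Z p ×ᵈ Δ⁰₀ᵈ S≤Z q
    Δ⁰₀ᵈ S≤Z (disj p q)    = Δ⁰₀ᵈ S≤Z p ⊎ᵈ Δ⁰₀ᵈ S≤Z q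
    Δ⁰₀ᵈ S≤Z (impl p q)    = Δ⁰₀ᵈ S≤Z p →ᵈ Δ⁰₀ᵈ S≤Z q
    Δ⁰₀ᵈ S≤Z (all< {t} p)  = mapᵈ
      (λ v → mk⇔ (λ f n q → f n (subst (n <_) (⟦wkᵗ⟧ t) q)) (λ f n q → f n (subst (n <_) (sym (⟦wkᵗ⟧ t)) q)))
      (∀<ᵈ (termᶜ t) (Δ⁰₀ᵈ S≤Z p))
    Δ⁰₀ᵈ S≤Z (ex< {t} p)   = mapᵈ
      (λ v → mk⇔ (λ (n , q , r) → n , subst (n <_) (sym (⟦wkᵗ⟧ t)) q , r) (λ (n , q , r) → n , subst (n <_) (⟦wkᵗ⟧ t) q , r))
      (∃<ᵈ (termᶜ t) (Δ⁰₀ᵈ S≤Z p))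

-- Soundness of RCA₀ in Turing ideals

module Soundness (em : ExcludedMiddle 0ℓ) (M : 𝟚^ω → Set) (ideal : TuringIdeal M) where
  open Semantics M
  open TuringIdeal ideal

  -- A formula may have many set parameters but a computation has one oracle; their iterated join
  -- stays in `M`.
  upper-bound : ∀ {k} (S : Vec 𝟚^ω k) → (∀ X → M (lookup S X)) → ∃[ Z ] M Z × ∀ X → lookup S X ≤ᵀ Z
  upper-bound [] mS = let Z , mZ = nonempty in Z , mZ , λ ()
  upper-bound (X ∷ S) mS =
    let Z , mZ , S≤Z = upper-bound S (mS ∘ suc) in
    X ⊕ Z , ⊕-closed (mS zero) mZ ,
    λ { zero → ≤ᵀ-⊕ˡ X Z ; (suc Y) → ≤ᵀ-trans (S≤Z Y) (≤ᵀ-⊕ʳ X Z) }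

  -- To decide φ = ∃̇ φ₀, search for a witness of φ₀ or a counterexample to ψ₀.
  comprehension : ∀ {m k} {φ ψ : Form (suc m) k} → Σ⁰₁ φ → Π⁰₁ ψ → ∀ v S → (∀ X → M (lookup S X)) →
    (∀ n → ⟦ φ ⇔̇ ψ ⟧ (n ∷ v) S) → ∃[ X ] M X × ∀ n → X n ≡ true ⇔ ⟦ φ ⟧ (n ∷ v) S
  comprehension {m} {k} (ex {φ₀} φᵈ) (all {ψ₀} ψᵈ) v S mS same =
    X , ≤ᵀ-closed (Decidable⇒≤ᵀ X≤Z) (proj₁ (proj₂ ub)) , correct
    where
    X : 𝟚^ω
    X n = ⌊ em {⟦ ∃̇ φ₀ ⟧ (n ∷ v) S} ⌋
    correct : ∀ n → X n ≡ true ⇔ ⟦ ∃̇ φ₀ ⟧ (n ∷ v) S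
    correct n with em {⟦ ∃̇ φ₀ ⟧ (n ∷ v) S}
    ... | yes p = mk⇔ (λ _ → p) (λ _ → refl)
    ... | no ¬p = mk⇔ (λ ()) (λ p → ⊥-elim (¬p p))
    ub : ∃[ Z ] M Z × ∀ X → lookup S X ≤ᵀ Z
    ub = upper-bound S mS
    Z : 𝟚^ω
    Z = proj₁ ub
    params : ∀ {n j} (w : Vec ℕ j) → Computables Z {n} (λ _ → w)
    params []      = []ᶜ
    params (x ∷ w) = constᶜ x ∷ᶜ params w
    env : Computables Z {2} (λ w → lookup w (# 0) ∷ lookup w (# 1) ∷ v)
    env = #0 ∷ᶜ #1 ∷ᶜ params v
    φ? : Decidable Z {2} (λ w → ⟦ φ₀ ⟧ (lookup w (# 0) ∷ lookup w (# 1) ∷ v) S)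
    φ? = Δ⁰₀ᵈ (proj₂ (proj₂ ub)) φᵈ ∘ᵈ env
    ψ? : Decidable Z {2} (λ w → ⟦ ψ₀ ⟧ (lookup w (# 0) ∷ lookup w (# 1) ∷ v) S)
    ψ? = Δ⁰₀ᵈ (proj₂ (proj₂ ub)) ψᵈ ∘ᵈ env
    exists : ∀ w → ∃[ p ] (⟦ φ₀ ⟧ (p ∷ lookup w (# 0) ∷ v) S ⊎ ¬ ⟦ ψ₀ ⟧ (p ∷ lookup w (# 0) ∷ v) S)
    exists (n ∷ []) with em {⟦ ∃̇ φ₀ ⟧ (n ∷ v) S} | em {∃[ p ] ¬ ⟦ ψ₀ ⟧ (p ∷ n ∷ v) S}
    ... | yes (p , q) | _ = p , inj₁ q
    ... | no _ | yes (p , q) = p , inj₂ q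
    ... | no ¬p | no ¬q = ⊥-elim (¬p (proj₂ (same n) λ p → stable λ r → ¬q (p , r)))
      where
      stable : ∀ {A : Set} → ¬ ¬ A → A
      stable {A} h with em {A}
      ... | yes a = a
      ... | no ¬a = ⊥-elim (h ¬a)
    found : ∃[ f ] Computable Z f × (∀ w → ⟦ φ₀ ⟧ (f w ∷ lookup w (# 0) ∷ v) S ⊎ ¬ ⟦ ψ₀ ⟧ (f w ∷ lookup w (# 0) ∷ v) S)
    found = search (φ? ⊎ᵈ ¬ᵈ ψ?) exists
    X≤Z : Decidable Z {1} (λ w → X (head w) ≡ true)
    X≤Z = mapᵈ (λ { (n ∷ []) → mk⇔ (λ p → from (correct n) (_ , p)) (λ x → witness n (to (correct n) x)) })
      (φ? ∘ᵈ (proj₁ (proj₂ found) ∷ᶜ #0 ∷ᶜ []ᶜ))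
      where
      -- If `φ` holds then so does `ψ`, and the search cannot have stopped at a counterexample to
      -- `ψ₀`; testing `φ₀` at the number found therefore decides `φ`.
      witness : ∀ n → ⟦ ∃̇ φ₀ ⟧ (n ∷ v) S → ⟦ φ₀ ⟧ (proj₁ found (n ∷ []) ∷ n ∷ v) S
      witness n φ with proj₂ (proj₂ found) (n ∷ [])
      ... | inj₁ p = p
      ... | inj₂ q = ⊥-elim (q (proj₁ (same n) φ _))

  axiom-sound : ∀ {m k} {φ : Form m k} → RCA₀ φ → ∀ v S → (∀ X → M (lookup S X)) → ⟦ φ ⟧ v S
  axiom-sound (suc≢0 s) v S mS p = m+1+n≢0 (⟦ s ⟧ᵗ v) p
  axiom-sound (suc-inj s t) v S mS p = +-cancelʳ-≡ 1 _ _ p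
  axiom-sound (+-zero s) v S mS = +-identityʳ _
  axiom-sound (+-suc s t) v S mS = sym (+-assoc (⟦ s ⟧ᵗ v) _ _)
  axiom-sound (·-zero s) v S mS = *-zeroʳ (⟦ s ⟧ᵗ v)
  axiom-sound (·-suc s t) v S mS =
    trans (*-distribˡ-+ (⟦ s ⟧ᵗ v) (⟦ t ⟧ᵗ v) 1) (cong (⟦ s ⟧ᵗ v * ⟦ t ⟧ᵗ v +_) (*-identityʳ _))
  axiom-sound (<-zero s) v S mS ()
  axiom-sound (<-suc s t) v S mS =
      (λ p → m<1+n⇒m<n∨m≡n (subst (⟦ s ⟧ᵗ v <_) (+-comm _ 1) p))
    , [ (λ p → <-≤-trans p (m≤m+n _ 1)) , (λ p → subst (⟦ s ⟧ᵗ v <_) (+-comm 1 _) (s≤s (≤-reflexive p))) ]′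
  axiom-sound (Σ⁰₁-induction {φ} _) v S mS (base , ind) = go
    where
    go : ∀ n → ⟦ φ ⟧ (n ∷ v) S
    go zero    = to (⟦[]⟧ φ 0̇) base
    go (suc n) = subst (λ i → ⟦ φ ⟧ (i ∷ v) S) (+-comm n 1) (to (⟦sub⟧ (⟦shift⟧ n v) φ) (ind n (go n)))
  axiom-sound (Δ⁰₁-comprehension {φ} p q) v S mS same =
    let X , mX , h = comprehension p q v S mS same in
    X , mX , λ n → (λ x → from (⟦wk²⟧ φ) (to (h n) x)) , (λ x → from (h n) (to (⟦wk²⟧ φ) x))

  sound : ∀ {m k} {Γ : List (Form m k)} {φ} → Γ ⊢ φ → ∀ v S → (∀ X → M (lookup S X)) →
          All (λ ψ → ⟦ ψ ⟧ v S) Γ → ⟦ φ ⟧ v S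
  sound (ax a) v S mS γ = axiom-sound a v S mS
  sound (hyp x) v S mS γ = All.lookup γ x
  sound (raa {φ} d) v S mS γ with em {⟦ φ ⟧ v S}
  ... | yes p = p
  ... | no ¬p = ⊥-elim (sound d v S mS (¬p ∷ γ))
  sound (⇒I d) v S mS γ = λ p → sound d v S mS (p ∷ γ)
  sound (⇒E d d′) v S mS γ = sound d v S mS γ (sound d′ v S mS γ)
  sound (∧I d d′) v S mS γ = sound d v S mS γ , sound d′ v S mS γ
  sound (∧E₁ d) v S mS γ = proj₁ (sound d v S mS γ)
  sound (∧E₂ d) v S mS γ = proj₂ (sound d v S mS γ)
  sound (∨I₁ d) v S mS γ = inj₁ (sound d v S mS γ)
  sound (∨I₂ d) v S mS γ = inj₂ (sound d v S mS γ)
  sound (∨E d d₁ d₂) v S mS γ with sound d v S mS γ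
  ... | inj₁ p = sound d₁ v S mS (p ∷ γ)
  ... | inj₂ p = sound d₂ v S mS (p ∷ γ)
  sound (∀I d) v S mS γ = λ n → sound d (n ∷ v) S mS (All.map⁺ (All.map (λ {ψ} → from (⟦wk⟧ ψ)) γ))
  sound (∀E {φ} d t) v S mS γ = from (⟦[]⟧ φ t) (sound d v S mS γ (⟦ t ⟧ᵗ v))
  sound (∃I {φ} t d) v S mS γ = ⟦ t ⟧ᵗ v , to (⟦[]⟧ φ t) (sound d v S mS γ)
  sound (∃E {θ = θ} d d′) v S mS γ = let n , p = sound d v S mS γ in
    to (⟦wk⟧ θ) (sound d′ (n ∷ v) S mS (p ∷ All.map⁺ (All.map (λ {ψ} → from (⟦wk⟧ ψ)) γ)))
  sound (∀²I d) v S mS γ = λ X mX →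
    sound d v (X ∷ S) (λ { zero → mX ; (suc Y) → mS Y }) (All.map⁺ (All.map (λ {ψ} → from (⟦wk²⟧ ψ)) γ))
  sound (∀²E {φ} d X) v S mS γ = from (⟦[]²⟧ φ X) (sound d v S mS γ (lookup S X) (mS X))
  sound (∃²I {φ} X d) v S mS γ = lookup S X , mS X , to (⟦[]²⟧ φ X) (sound d v S mS γ)
  sound (∃²E {θ = θ} d d′) v S mS γ = let X , mX , p = sound d v S mS γ in
    to (⟦wk²⟧ θ) (sound d′ v (X ∷ S) (λ { zero → mX ; (suc Y) → mS Y })
      (p ∷ All.map⁺ (All.map (λ {ψ} → from (⟦wk²⟧ ψ)) γ)))
  sound ≈I v S mS γ = refl
  sound (≈E {φ} {s} {t} d d′) v S mS γ =
    from (⟦[]⟧ φ t) (subst (λ n → ⟦ φ ⟧ (n ∷ v) S) (sound d v S mS γ) (to (⟦[]⟧ φ s) (sound d′ v S mS γ)))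

-- Arithmetisation of Φ

modulus : ℕ → ℕ → ℕ
modulus m i = m * (i + 1) + 1

coprime-∣ : ∀ {a b c} → c ∣ a → Coprime a b → Coprime c b
coprime-∣ c∣a cop (d∣c , d∣b) = cop (∣-trans d∣c c∣a , d∣b)

coprime-* : ∀ {a b c} → Coprime a b → Coprime a c → Coprime a (b * c)
coprime-* ab ac (d∣a , d∣bc) = ac (d∣a , coprime-divisor (coprime-∣ d∣a ab) d∣bc)

1≤n≤k⇒n∣k! : ∀ {k n} → 1 ≤ n → n ≤ k → n ∣ k !
1≤n≤k⇒n∣k! {n = suc n} _ n≤k = ∣-trans (m∣m*n (n !)) (m≤n⇒m!∣n! n≤k)

modulus-coprime : ∀ m i → Coprime (modulus m i) m
modulus-coprime m i (d∣mod , d∣m) = ∣1⇒≡1 (∣m+n∣m⇒∣n d∣mod (∣m⇒∣m*n (i + 1) d∣m))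

-- A common divisor `d` divides `m * (j ∸ i)`, hence `m * m`, because `j ∸ i` divides `k !`. Being
-- coprime to `m`, it divides `m` and so equals 1.
moduli-coprime-< : ∀ {k i j} → i < j → j < k → Coprime (modulus (k !) i) (modulus (k !) j)
moduli-coprime-< {k} {i} {j} i<j j<k {d} (d∣i , d∣j) =
  modulus-coprime m i (d∣i , coprime-divisor d-m (∣-trans d∣diff (*-monoʳ-∣ m (1≤n≤k⇒n∣k! (m<n⇒0<n∸m i<j) j∸i≤k))))
  where
  m = k !
  d-m : Coprime d m
  d-m = coprime-∣ d∣i (modulus-coprime m i)
  j∸i≤k : j ∸ i ≤ k
  j∸i≤k = ≤-trans (m∸n≤m j i) (<⇒≤ j<k)
  difference : modulus m j ≡ modulus m i + m * (j ∸ i)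
  difference = trans (cong (λ j → m * (j + 1) + 1) (sym (m+[n∸m]≡n (<⇒≤ i<j)))) (lemma m i (j ∸ i))
    where
    lemma : ∀ m i e → m * (i + e + 1) + 1 ≡ m * (i + 1) + 1 + m * e
    lemma = solve-∀
  d∣diff : d ∣ m * (j ∸ i)
  d∣diff = ∣m+n∣m⇒∣n (subst (d ∣_) difference d∣j) d∣i

moduli-coprime : ∀ {k i j} → i ≢ j → i < k → j < k → Coprime (modulus (k !) i) (modulus (k !) j)
moduli-coprime {i = i} {j} i≢j i<k j<k with <-cmp i j
... | tri< i<j _ _ = moduli-coprime-< i<j j<k
... | tri≈ _ i≡j _ = ⊥-elim (i≢j i≡j)
... | tri> _ _ j<i = Coprimality.sym (moduli-coprime-< j<i i<k)

module _ {P : ℕ → Set} (P? : ∀ i → Dec (P i)) (k : ℕ) where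

  factor : ∀ {i} → Dec (P i) → ℕ
  factor {i} (yes _) = modulus (k !) i
  factor     (no _)  = 1

  code : ℕ → ℕ
  code zero    = 1
  code (suc j) = factor (P? j) * code j

  code-∣ : ∀ {i j} → i < j → P i → modulus (k !) i ∣ code j
  code-∣ {i} {suc j} i<j p with m<1+n⇒m<n∨m≡n i<j
  ... | inj₁ i<j′ = ∣n⇒∣m*n (factor (P? j)) (code-∣ i<j′ p)
  ... | inj₂ refl with P? i
  ...   | yes _ = m∣m*n (code i)
  ...   | no ¬p = ⊥-elim (¬p p)

  code-coprime : ∀ {i} j → i < k → j ≤ k → ¬ P i → Coprime (modulus (k !) i) (code j)
  code-coprime zero i<k j≤k ¬p (_ , d∣1) = ∣1⇒≡1 d∣1
  code-coprime {i} (suc j) i<k j<k ¬p =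
    coprime-* (step (P? j)) (code-coprime j i<k (<⇒≤ j<k) ¬p)
    where
    step : (p? : Dec (P j)) → Coprime (modulus (k !) i) (factor p?)
    step (yes p) = moduli-coprime (λ { refl → ¬p p }) i<k j<k
    step (no _) (_ , d∣1) = ∣1⇒≡1 d∣1

  -- The code is the product of the moduli of the members. A modulus of a non-member is coprime to
  -- it, so if it divided the code it would be 1; but it is at least 2.
  code-correct : ∀ i → i < k → modulus (k !) i ∣ code k ⇔ P i
  code-correct i i<k = mk⇔ sound′ (code-∣ i<k)
    where
    big : modulus (k !) i ≢ 1
    big p = <⇒≢ (*-mono-≤ (1≤n! k) (m≤n+m 1 i)) (sym (+-cancelʳ-≡ 1 _ 0 p))
    sound′ : modulus (k !) i ∣ code k → P i
    sound′ d with P? i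
    ... | yes p = p
    ... | no ¬p = ⊥-elim (big (code-coprime k i<k ≤-refl ¬p (∣-refl , d)))

InD : (k m n i : ℕ) → Set
InD k m n i = i < k × ∃[ z ] z < n + 1 × modulus m i * z ≡ n

finite-set : ∀ (L : List ℕ) → ∃[ k ] ∃[ m ] ∃[ n ] ∀ i → InD k m n i ⇔ i ∈ L
finite-set L = k , k ! , code ∈L k k , λ i → mk⇔ (sound′ i) (complete i)
  where
  ∈L : ∀ i → Dec (i ∈ L)
  ∈L i = _∈?_ _≟_ i L
  size : List ℕ → ℕ
  size []      = 0
  size (x ∷ L) = suc x ⊔ size L
  <size : ∀ {i} L → i ∈ L → i < size L
  <size (x ∷ L) (here refl) = m≤m⊔n (suc x) (size L)
  <size (x ∷ L) (there p)   = ≤-trans (<size L p) (m≤n⊔m (suc x) (size L))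
  k = size L
  sound′ : ∀ i → InD k (k !) (code ∈L k k) i → i ∈ L
  sound′ i (i<k , z , _ , p) = to (code-correct ∈L k i i<k) (divides z (trans (sym p) (*-comm (modulus (k !) i) z)))
  complete : ∀ i → i ∈ L → InD k (k !) (code ∈L k k) i
  complete i p with from (code-correct ∈L k i (<size L p)) p
  ... | divides q n≡q*d = <size L p , q
    -- The modulus is positive, so the cofactor is at most the code, as the bound in `InD` demands.
    , subst (q <_) (+-comm 1 (code ∈L k k))
        (s≤s (≤-trans (m≤m*n q (modulus (k !) i) {{>-nonZero (m≤n+m 1 (k ! * (i + 1)))}}) (≤-reflexive (sym n≡q*d))))
    , trans (*-comm (modulus (k !) i) q) (sym n≡q*d)

-- Derivations as finite sets of timed steps

stepᶜ : (t c u w : ℕ) → ℕ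
stepᶜ t c u w = ⟨ t , ⟨ c , ⟨ u , w ⟩ ⟩ ⟩

record Earlier (D : ℕ → Set) (t c u w : ℕ) : Set where
  constructor earlier
  field
    time   : ℕ
    time<t : time < t
    taken  : D (stepᶜ time c u w)

-- One constructor per disjunct of the formula `justified`. The set `D` is a parameter so that
-- justification can move from a list to the set coded by `(k , m , n)`.
data Justified (X : 𝟚^ω) (D : ℕ → Set) (t : ℕ) : (c u w : ℕ) → Set where
  zerʲ   : ∀ {u} → Justified X D t ⟨ 0 , 0 ⟩ u 0
  succʲ  : ∀ {u} → Justified X D t ⟨ 1 , 0 ⟩ u (u + 1)
  idenʲ  : ∀ {u} → Justified X D t ⟨ 2 , 0 ⟩ u u
  leftʲ  : ∀ x y → Justified X D t ⟨ 3 , 0 ⟩ ⟨ x , y ⟩ x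
  rightʲ : ∀ x y → Justified X D t ⟨ 4 , 0 ⟩ ⟨ x , y ⟩ y
  queryʲ : ∀ {u} → Justified X D t ⟨ 5 , 0 ⟩ u (χ X u)
  pairʲ  : ∀ a b {u} p q → Earlier D t a u p → Earlier D t b u q →
           Justified X D t ⟨ 6 , ⟨ a , b ⟩ ⟩ u ⟨ p , q ⟩
  compʲ  : ∀ a b {u} p {w} → Earlier D t b u p → Earlier D t a p w →
           Justified X D t ⟨ 7 , ⟨ a , b ⟩ ⟩ u w
  rec₀ʲ  : ∀ a b p {w} → Earlier D t a p w → Justified X D t ⟨ 8 , ⟨ a , b ⟩ ⟩ ⟨ p , 0 ⟩ w
  rec₊ʲ  : ∀ a b p q r {w} → Earlier D t ⟨ 8 , ⟨ a , b ⟩ ⟩ ⟨ p , q ⟩ r → Earlier D t b ⟨ p , ⟨ q , r ⟩ ⟩ w →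
           Justified X D t ⟨ 8 , ⟨ a , b ⟩ ⟩ ⟨ p , q + 1 ⟩ w
  stopʲ  : ∀ a b w → Earlier D t a ⟨ b , w ⟩ 0 → Justified X D t ⟨ 9 , a ⟩ ⟨ b , w ⟩ w
  nextʲ  : ∀ a b p q {w} → Earlier D t a ⟨ b , p ⟩ (q + 1) → Earlier D t ⟨ 9 , a ⟩ ⟨ b , p + 1 ⟩ w →
           Justified X D t ⟨ 9 , a ⟩ ⟨ b , p ⟩ w

module _ {D E : ℕ → Set} (D⊆E : ∀ {i} → D i → E i) where

  earlier-map : ∀ {t c u w} → Earlier D t c u w → Earlier E t c u w
  earlier-map (earlier t′ t′<t p) = earlier t′ t′<t (D⊆E p)

  justified-map : ∀ {X t c u w} → Justified X D t c u w → Justified X E t c u w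
  justified-map zerʲ = zerʲ
  justified-map succʲ = succʲ
  justified-map idenʲ = idenʲ
  justified-map (leftʲ x y) = leftʲ x y
  justified-map (rightʲ x y) = rightʲ x y
  justified-map queryʲ = queryʲ
  justified-map (pairʲ a b p q f g) = pairʲ a b p q (earlier-map f) (earlier-map g)
  justified-map (compʲ a b p f g) = compʲ a b p (earlier-map f) (earlier-map g)
  justified-map (rec₀ʲ a b p f) = rec₀ʲ a b p (earlier-map f)
  justified-map (rec₊ʲ a b p q r f g) = rec₊ʲ a b p q r (earlier-map f) (earlier-map g)
  justified-map (stopʲ a b w f) = stopʲ a b w (earlier-map f)
  justified-map (nextʲ a b p q f g) = nextʲ a b p q (earlier-map f) (earlier-map g)

WellJustified : 𝟚^ω → List ℕ → Set
WellJustified X L = ∀ t c u w → stepᶜ t c u w ∈ L → Justified X (_∈ L) t c u w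

record Trace (X : 𝟚^ω) (c u w : ℕ) : Set where
  constructor mkTrace
  field
    steps     : List ℕ
    last      : ℕ
    concludes : stepᶜ last c u w ∈ steps
    justifies : WellJustified X steps

-- Justification asks only for the presence of steps, so it survives enlarging the list; injectivity
-- of pairing identifies the new step.
add-step : ∀ {X L} t c u w → WellJustified X L → Justified X (_∈ L) t c u w → Trace X c u w
add-step {X} {L} t c u w wj j = mkTrace (stepᶜ t c u w ∷ L) t (here refl) λ t′ c′ u′ w′ → λ
  { (here eqn) → justified-map there (transport t′ c′ u′ w′ eqn)
  ; (there p)  → justified-map there (wj t′ c′ u′ w′ p) }
  where
  transport : ∀ t′ c′ u′ w′ → stepᶜ t′ c′ u′ w′ ≡ stepᶜ t c u w → Justified X (_∈ L) t′ c′ u′ w′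
  transport t′ c′ u′ w′ eqn
    with refl , eqn₁ ← ⟨⟩-injective {t′} {⟨ c′ , ⟨ u′ , w′ ⟩ ⟩} {t} {⟨ c , ⟨ u , w ⟩ ⟩} eqn
    with refl , eqn₂ ← ⟨⟩-injective {c′} {⟨ u′ , w′ ⟩} {c} {⟨ u , w ⟩} eqn₁
    with refl , refl ← ⟨⟩-injective {u′} {w′} {u} {w} eqn₂ = j

step₀ : ∀ {X} c u w → Justified X (_∈ []) 0 c u w → Trace X c u w
step₀ c u w = add-step 0 c u w (λ t c u w ())

step₁ : ∀ {X c₁ u₁ w₁} c u w → Trace X c₁ u₁ w₁ →
  (∀ {D t} → Earlier D t c₁ u₁ w₁ → Justified X D t c u w) → Trace X c u w
step₁ c u w (mkTrace L t p wj) j = add-step (suc t) c u w wj (j (earlier t ≤-refl p))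

-- Times are stamps that may repeat, so two traces are merged by concatenation without renumbering.
step₂ : ∀ {X c₁ u₁ w₁ c₂ u₂ w₂} c u w → Trace X c₁ u₁ w₁ → Trace X c₂ u₂ w₂ →
  (∀ {D t} → Earlier D t c₁ u₁ w₁ → Earlier D t c₂ u₂ w₂ → Justified X D t c u w) → Trace X c u w
step₂ {X} c u w (mkTrace L₁ t₁ p₁ wj₁) (mkTrace L₂ t₂ p₂ wj₂) j = add-step {L = L₁ ++ L₂} (suc (t₁ ⊔ t₂)) c u w
  (λ t c u w p → [ justified-map ∈-++⁺ˡ ∘ wj₁ t c u w , justified-map (∈-++⁺ʳ L₁) ∘ wj₂ t c u w ]′ (∈-++⁻ L₁ p))
  (j (earlier t₁ (s≤s (m≤m⊔n t₁ t₂)) (∈-++⁺ˡ p₁)) (earlier t₂ (s≤s (m≤n⊔m t₁ t₂)) (∈-++⁺ʳ L₁ p₂)))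

trace : ∀ {X c u w} → Φ X c u w → Trace X c u w
trace (zer {x}) = step₀ ⟨ 0 , 0 ⟩ x 0 zerʲ
trace (succ {x}) = step₀ ⟨ 1 , 0 ⟩ x (x + 1) succʲ
trace (iden {x}) = step₀ ⟨ 2 , 0 ⟩ x x idenʲ
trace (left {x} {y}) = step₀ ⟨ 3 , 0 ⟩ ⟨ x , y ⟩ x (leftʲ x y)
trace (right {x} {y}) = step₀ ⟨ 4 , 0 ⟩ ⟨ x , y ⟩ y (rightʲ x y)
trace {X} (query {x}) = step₀ ⟨ 5 , 0 ⟩ x (χ X x) queryʲ
trace (pair {a} {b} {x} {y} {z} φ ψ) =
  step₂ ⟨ 6 , ⟨ a , b ⟩ ⟩ x ⟨ y , z ⟩ (trace φ) (trace ψ) (pairʲ a b y z)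
trace (comp {a} {b} {x} {y} {z} φ ψ) =
  step₂ ⟨ 7 , ⟨ a , b ⟩ ⟩ x z (trace φ) (trace ψ) (compʲ a b y)
trace (rec₀ {a} {b} {x} {y} φ) =
  step₁ ⟨ 8 , ⟨ a , b ⟩ ⟩ ⟨ x , 0 ⟩ y (trace φ) (rec₀ʲ a b x)
trace (rec₊ {a} {b} {x} {n} {y} {z} φ ψ) =
  step₂ ⟨ 8 , ⟨ a , b ⟩ ⟩ ⟨ x , n + 1 ⟩ z (trace φ) (trace ψ) (rec₊ʲ a b x n y)
trace (stop {a} {x} {n} φ) = step₁ ⟨ 9 , a ⟩ ⟨ x , n ⟩ n (trace φ) (stopʲ a x n)
trace (next {a} {x} {n} {y} {z} φ ψ) =
  step₂ ⟨ 9 , a ⟩ ⟨ x , n ⟩ z (trace φ) (trace ψ) (nextʲ a x n y)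

<-fst : ∀ {k} a b → ⟨ a , b ⟩ < k → a < k
<-fst a b = ≤-<-trans (≤⟨⟩₁ a b)

<-snd : ∀ {k} a b → ⟨ a , b ⟩ < k → b < k
<-snd a b = ≤-<-trans (≤⟨⟩₂ a b)

-- From derivations to truth of the arithmetised formula

module ArithmetisedTruth (M : 𝟚^ω → Set) {s} (X̂ : Fin s) (S : Vec 𝟚^ω s) where
  open Semantics M
  open Arithmetisation X̂ using (justified; formula)

  X : 𝟚^ω
  X = lookup S X̂

  module _ {k m n : ℕ} where

    value< : ∀ {t c u w} → Earlier (InD k m n) t c u w → w < k
    value< {t} {c} {u} {w} (earlier t′ _ (i<k , _)) =
      <-snd u w (<-snd c ⟨ u , w ⟩ (<-snd t′ ⟨ c , ⟨ u , w ⟩ ⟩ i<k))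

    query-true : ∀ u → (X u ≡ true × χ X u ≡ 1) ⊎ (¬ X u ≡ true × χ X u ≡ 0)
    query-true u with X u
    ... | true  = inj₁ (refl , refl)
    ... | false = inj₂ ((λ ()) , refl)

    out : ∀ {t c u w} → Earlier (InD k m n) t c u w → ∃[ t′ ] t′ < t × InD k m n (stepᶜ t′ c u w)
    out (earlier t′ t′<t p) = t′ , t′<t , p

    tag₁ : ∀ tag a b → ⟨ tag , ⟨ a , b ⟩ ⟩ < k → a < k
    tag₁ tag a b p = <-fst a b (<-snd tag ⟨ a , b ⟩ p)

    tag₂ : ∀ tag a b → ⟨ tag , ⟨ a , b ⟩ ⟩ < k → b < k
    tag₂ tag a b p = <-snd a b (<-snd tag ⟨ a , b ⟩ p)

    -- Each bounded witness is at most a component of `c`, `u` or `w`, or the value of an earlier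
    -- step; pairing dominates its components, so all of these are below `k`.
    justified-true : ∀ {e x y t c u w} → Justified X (InD k m n) t c u w → c < k → u < k → w < k →
      ⟦ justified ⟧ (w ∷ u ∷ c ∷ t ∷ n ∷ m ∷ k ∷ y ∷ x ∷ e ∷ []) S
    justified-true zerʲ _ _ _ = inj₁ (refl , refl)
    justified-true succʲ _ _ _ = inj₂ (inj₁ (refl , refl))
    justified-true idenʲ _ _ _ = inj₂ (inj₂ (inj₁ (refl , refl)))
    justified-true (leftʲ a b) _ u<k _ = inj₂ (inj₂ (inj₂ (inj₁ (refl , b , <-snd a b u<k , refl))))
    justified-true (rightʲ a b) _ u<k _ = inj₂ (inj₂ (inj₂ (inj₂ (inj₁ (refl , a , <-fst a b u<k , refl)))))
    justified-true (queryʲ {u}) _ _ _ = inj₂ (inj₂ (inj₂ (inj₂ (inj₂ (inj₁ (refl , query-true u))))))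
    justified-true (pairʲ a b p q f g) c<k _ w<k =
      inj₂ (inj₂ (inj₂ (inj₂ (inj₂ (inj₂ (inj₁
        (a , tag₁ 6 a b c<k , b , tag₂ 6 a b c<k , p , <-fst p q w<k , q , <-snd p q w<k
        , refl , refl , out f , out g)))))))
    justified-true (compʲ a b p f g) c<k _ _ =
      inj₂ (inj₂ (inj₂ (inj₂ (inj₂ (inj₂ (inj₂ (inj₁
        (a , tag₁ 7 a b c<k , b , tag₂ 7 a b c<k , p , value< f , refl , out f , out g))))))))
    justified-true (rec₀ʲ a b p f) c<k u<k _ =
      inj₂ (inj₂ (inj₂ (inj₂ (inj₂ (inj₂ (inj₂ (inj₂ (inj₁
        (a , tag₁ 8 a b c<k , b , tag₂ 8 a b c<k , p , <-fst p 0 u<k , refl , refl , out f)))))))))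
    justified-true (rec₊ʲ a b p q r f g) c<k u<k _ =
      inj₂ (inj₂ (inj₂ (inj₂ (inj₂ (inj₂ (inj₂ (inj₂ (inj₂ (inj₁
        (a , tag₁ 8 a b c<k , b , tag₂ 8 a b c<k , p , <-fst p (q + 1) u<k
        , q , ≤-<-trans (m≤m+n q 1) (<-snd p (q + 1) u<k) , r , value< f
        , refl , refl , out f , out g))))))))))
    justified-true (stopʲ a b w f) c<k u<k _ =
      inj₂ (inj₂ (inj₂ (inj₂ (inj₂ (inj₂ (inj₂ (inj₂ (inj₂ (inj₂ (inj₁
        (a , <-snd 9 a c<k , b , <-fst b w u<k , refl , refl , out f)))))))))))
    justified-true (nextʲ a b p q f g) c<k u<k _ =
      inj₂ (inj₂ (inj₂ (inj₂ (inj₂ (inj₂ (inj₂ (inj₂ (inj₂ (inj₂ (inj₂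
        (a , <-snd 9 a c<k , b , <-fst b p u<k , p , <-snd b p u<k
        , q , ≤-<-trans (m≤m+n q 1) (value< f) , refl , refl , out f , out g)))))))))))

  formula-true : ∀ {e x y} → Φ X e x y → ⟦ formula ⟧ (y ∷ x ∷ e ∷ []) S
  formula-true {e} {x} {y} φ =
    let mkTrace L last ∈L wj = trace φ
        k , m , n , D = finite-set L
    in k , m , n , (last , from (D (stepᶜ last e x y)) ∈L) ,
       λ t _ c c<k u u<k w w<k d →
         justified-true {k} {m} {n} {e} {x} {y} {t} {c} {u} {w}
           (justified-map (λ {i} → from (D i)) (wj t c u w (to (D (stepᶜ t c u w)) d))) c<k u<k w<k

  Φ̇-true : ∀ {m} (v : Vec ℕ m) e x y → Φ X (⟦ e ⟧ᵗ v) (⟦ x ⟧ᵗ v) (⟦ y ⟧ᵗ v) → ⟦ Φ̇ X̂ e x y ⟧ v S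
  Φ̇-true {m} v e x y φ = from
    (⟦sub⟧ {σ = lookup (y ∷ x ∷ e ∷ [])} {v} {⟦ y ⟧ᵗ v ∷ ⟦ x ⟧ᵗ v ∷ ⟦ e ⟧ᵗ v ∷ []} {S}
      (substitutes λ { zero → refl ; (suc zero) → refl ; (suc (suc zero)) → refl }) formula)
    (formula-true φ)

-- Truth of COH and DNR in an ω-model

module _ (M : 𝟚^ω → Set) where
  open Semantics M

  ModelsCOH⇒COH-true : ModelsCOH M → ⟦ COH ⟧ [] []
  ModelsCOH⇒COH-true coh R mR = let X , mX , inf , homog = coh R mR in
    X , mX , inf , λ i → [ (λ (b , h) → inj₁ (b , λ n (p , q) → h n (from ∧-true (p , q))))
                         , (λ (b , h) → inj₂ (b , λ n (p , q) → h n (from ∧-true (p , from not-true q)))) ]′ (homog i)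

  -- The values of `f` are the witnesses of the totality clause, and its uniqueness part makes `F`
  -- the graph of `f`. If `f e` were a value of `Φ` at `e`, then `Φ̇` would be true there, against
  -- the diagonal clause.
  DNR-true⇒ModelsDNR : ⟦ DNR ⟧ [] [] → ModelsDNR M
  DNR-true⇒ModelsDNR dnr X mX = let F , mF , func , diag = dnr X mX in
    (λ e → proj₁ (func e)) ,
    (F , mF , λ e y → mk⇔ (λ p → sym (proj₂ (proj₂ (func e)) y p)) (λ { refl → proj₁ (proj₂ (func e)) })) ,
    λ { e y φ refl → diag e y (proj₁ (proj₂ (func e)))
          (ArithmetisedTruth.Φ̇-true M (suc zero) (F ∷ X ∷ []) (y ∷ e ∷ []) (level 0) (level 0) (level 1) φ) }

theorem3p7 : ExcludedMiddle 0ℓ →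
    (∃[ M ] TuringIdeal M × ModelsCOH M × ¬ ModelsDNR M)
    × ¬ ([] ⊢ COH ⇒̇ DNR)
theorem3p7 em = (M , M-ideal , M-COH , M-¬DNR) , λ d →
  M-¬DNR (DNR-true⇒ModelsDNR M (Soundness.sound em M M-ideal d [] [] (λ ()) [] (ModelsCOH⇒COH-true M M-COH)))
  where open Ideal em
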